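{- Let $\mathcal{C}$ be a category with finite products, weak equalisers and finite sums. Then $\mathcal{C}_{ex}$ is a model of CETCS if (i) every object of $\mathcal{C}$ is a choice object, (ii) the terminal object of $\mathcal{C}$ is non-degenerate and indecomposable, (iii) $\mathcal{C}$ is weakly lextensive and closed for pseudo-relations, and (iv) $\mathcal{C}$ has a weak natural numbers object.
   Context: Weak limits are like limits without uniqueness of mediating arrows. Global elements: an arrow $x\colon 1\to X$ is written $x\in X$; for $f\colon X\to Y$ and $y\in Y$, $y\in_f$ means some $x\in X$ has $fx=y$; $f$ is surjective if $y\in_f$ for all $y\in Y$; $Y$ is a choice object if every surjection onto $Y$ has a section. The terminal object is non-degenerate if it is not isomorphic to the initial object, and indecomposable if for every coproduct diagram $i\colon X\to S\leftarrow Y\colon j$ and every $z\in S$ we have $z\in_i$ or $z\in_j$. $\mathcal{C}$ is weakly lextensive if (a) finite sums are disjoint and the initial object is strict, (b) the canonical arrow $(X\times Y)+(X\times Z)\to X\times(Y+Z)$ is an isomorphism, (c) whenever $E_X\to X$ is a weak equaliser of a pair $X\rightrightarrows Z$ and $E_Y\to Y$ is a weak equaliser of a pair $Y\rightrightarrows Z$, then $E_X+E_Y\to X+Y$ is a weak equaliser of the induced pair $X+Y\rightrightarrows Z$. A weak natural numbers object is $N$ with $0\in N$ and $s\colon N\to N$ such that for every $X$, $x\in X$, $f\colon X\to X$ there is (not necessarily unique) $g\colon N\to X$ with $g0=x$ and $gs=fg$. Closed for pseudo-relations: for $g\colon Y\to X$, $f\colon X\to I$, a family of pseudo-relations over $f,g$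 is $h\colon J\to I$, $r\colon R\to J\times X\times Y$ (arbitrary arrows) with (a) $\langle j,x,y\rangle\in_r\Rightarrow gy=x$, (b) $fx=hj\iff\exists y\in Y\,\langle j,x,y\rangle\in_r$, for all elements $j,x,y$. A pseudo-relation over $f,g$ with domain index $i\in I$ is $r\colon R\to X\times Y$ with $\langle x,y\rangle\in_r\Rightarrow gy=x$ and $fx=i\iff\exists y\,\langle x,y\rangle\in_r$. A full family over $f,g$ is a family $\phi\colon F\to I$, $\alpha\colon P\to F\times X\times Y$ over $f,g$ such that for each pseudo-relation $r$ over $f,g$ with domain index $i$ there is $c\in F$ with $\phi c=i$ and $\langle c,x,y\rangle\in_\alpha\Rightarrow\langle x,y\rangle\in_r$ for all $x,y$. $\mathcal{C}$ is closed for pseudo-relations if every composable pair has a full family. Exact completion $\mathcal{C}_{ex}$: objects are pseudo-equivalence relations $r=\langle r_1,r_2\rangle\colon R\to X\times X$ (arrows for which there exist, not necessarily unique, $\rho\colon X\to R$ with $r\rho=\langle1,1\rangle$, $\sigma\colon R\to R$ with $r\sigma=\langle r_2,r_1\rangle$, and $\tau\colon Q\to R$ with $r\tau=\langle r_1p_1,r_2p_2\rangle$ for $(Q,p_1,p_2)$ a weak pullback of $r_2,r_1$); arrows $r\to s$ (with $s\colon S\to Y\times Y$) are classes $[f]$ of $f\colon X\to Y$ admitting $\hat f\colon R\to S$ with $s\hat f=(f\times f)r$, where $f\sim g$ iff some $h\colon X\to S$ has $sh=\langle f,g\rangle$. CETCS: a category $\mathcal{E}$ is a model of CETCS if: (C1)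 it has finite limits and finite colimits; (C2) every composable pair $Y\xrightarrow{g}X\xrightarrow{f}I$ has a universal dependent product, i.e. $\phi\colon F\to I$ and a mono $\alpha\colon P\rightarrowtail F\times X\times Y$ satisfying (a), (b) above and functionality ($\langle j,x,y\rangle\in_\alpha$, $\langle j,x',y'\rangle\in_\alpha$, $x=x'$ imply $y=y'$), such that for every mono $r\colon R\rightarrowtail X\times Y$ that is a pseudo-relation over $f,g$ with domain index $i$ and is functional, there is a unique $c\in F$ with $\phi c=i$ and $\langle c,x,y\rangle\in_\alpha\iff\langle x,y\rangle\in_r$ for all $x,y$; (C3) there is a natural numbers object; (C4) the terminal object is a strong generator (every $f\colon X\to Y$ such that each $y\in Y$ equals $fx$ for a unique $x\in X$ is iso) and separating ($fx=gx$ for all $x\in X$ implies $f=g$); (C5) every object is the codomain of a surjection from a choice object; (C6) the initial object has no global elements; (C7) the terminal object is indecomposable; (C8) in any coproduct diagram $i\colon1\to S\leftarrow1\colon j$, $i\neq j$; (C9) every arrow factors as a surjection followed by a mono; (C10) every equivalence relation is a kernel pair. -}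

module Defs where

open import Level using (Level; _⊔_) renaming (suc to lsuc)
open import Relation.Binary using (Rel; IsEquivalence; Setoid)
open import Data.Product using (Σ; _×_; _,_; proj₁; proj₂)
open import Data.Sum using (_⊎_)
open import Relation.Nullary using (¬_)
import Relation.Binary.Reasoning.Setoid as SetoidR

record Category (o ℓ e : Level) : Set (lsuc (o ⊔ ℓ ⊔ e)) where
  infix  4 _≈_ _⇒_
  infixr 9 _∘_
  field
    Obj : Set o
    _⇒_ : Obj → Obj → Set ℓ
    _≈_ : ∀ {A B} → Rel (A ⇒ B) e
    id  : ∀ {A} → A ⇒ A
    _∘_ : ∀ {A B C} → B ⇒ C → A ⇒ B → A ⇒ C
    equiv     : ∀ {A B} → IsEquivalence (_≈_ {A} {B})
    ∘-resp-≈  : ∀ {A B C} {f h : B ⇒ C} {g i : A ⇒ B} →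
                f ≈ h → g ≈ i → f ∘ g ≈ h ∘ i
    assoc     : ∀ {A B C D} {f : A ⇒ B} {g : B ⇒ C} {h : C ⇒ D} →
                (h ∘ g) ∘ f ≈ h ∘ (g ∘ f)
    identityˡ : ∀ {A B} {f : A ⇒ B} → id ∘ f ≈ f
    identityʳ : ∀ {A B} {f : A ⇒ B} → f ∘ id ≈ f

  homSetoid : Obj → Obj → Setoid ℓ e
  homSetoid A B = record { Carrier = A ⇒ B ; _≈_ = _≈_ ; isEquivalence = equiv }

  ≈refl : ∀ {A B} {f : A ⇒ B} → f ≈ f
  ≈refl = IsEquivalence.refl equiv
  ≈sym : ∀ {A B} {f g : A ⇒ B} → f ≈ g → g ≈ f
  ≈sym = IsEquivalence.sym equiv
  ≈trans : ∀ {A B} {f g h : A ⇒ B} → f ≈ g → g ≈ h → f ≈ h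
  ≈trans = IsEquivalence.trans equiv

  module HR {A B : Obj} where
    open SetoidR (homSetoid A B) public

_iff_ : ∀ {a b} → Set a → Set b → Set (a ⊔ b)
P iff Q = (P → Q) × (Q → P)

module Notions {o ℓ e} (C : Category o ℓ e) where
  open Category C

  Mono : ∀ {A B} → A ⇒ B → Set (o ⊔ ℓ ⊔ e)
  Mono {A} m = ∀ {W} (a b : W ⇒ A) → m ∘ a ≈ m ∘ b → a ≈ b

  IsIso : ∀ {A B} → A ⇒ B → Set (ℓ ⊔ e)
  IsIso {A} {B} f = Σ (B ⇒ A) λ g → (g ∘ f ≈ id) × (f ∘ g ≈ id)

  _≅_ : Obj → Obj → Set (ℓ ⊔ e)
  A ≅ B = Σ (A ⇒ B) IsIso

  IsTerminal : Obj → Set (o ⊔ ℓ ⊔ e)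
  IsTerminal T = ∀ X → Σ (X ⇒ T) λ u → ∀ (v : X ⇒ T) → v ≈ u

  IsInitial : Obj → Set (o ⊔ ℓ ⊔ e)
  IsInitial I = ∀ X → Σ (I ⇒ X) λ u → ∀ (v : I ⇒ X) → v ≈ u

  record Terminal : Set (o ⊔ ℓ ⊔ e) where
    field
      ⊤ : Obj
      isTerminal : IsTerminal ⊤
    ! : ∀ {X} → X ⇒ ⊤
    ! {X} = proj₁ (isTerminal X)

  record Initial : Set (o ⊔ ℓ ⊔ e) where
    field
      ⊥ : Obj
      isInitial : IsInitial ⊥
    ¡ : ∀ {X} → ⊥ ⇒ X
    ¡ {X} = proj₁ (isInitial X)

  IsProduct : ∀ {A B P} → P ⇒ A → P ⇒ B → Set (o ⊔ ℓ ⊔ e)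
  IsProduct {A} {B} {P} p₁ p₂ =
    ∀ {W} (f : W ⇒ A) (g : W ⇒ B) →
      Σ (W ⇒ P) λ u → (p₁ ∘ u ≈ f) × (p₂ ∘ u ≈ g) ×
        (∀ (u' : W ⇒ P) → p₁ ∘ u' ≈ f → p₂ ∘ u' ≈ g → u' ≈ u)

  IsCoproduct : ∀ {A B S} → A ⇒ S → B ⇒ S → Set (o ⊔ ℓ ⊔ e)
  IsCoproduct {A} {B} {S} i j =
    ∀ {W} (f : A ⇒ W) (g : B ⇒ W) →
      Σ (S ⇒ W) λ u → (u ∘ i ≈ f) × (u ∘ j ≈ g) ×
        (∀ (u' : S ⇒ W) → u' ∘ i ≈ f → u' ∘ j ≈ g → u' ≈ u)

  record Product (A B : Obj) : Set (o ⊔ ℓ ⊔ e) where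
    field
      obj : Obj
      π₁ : obj ⇒ A
      π₂ : obj ⇒ B
      isProduct : IsProduct π₁ π₂

  record Coproduct (A B : Obj) : Set (o ⊔ ℓ ⊔ e) where
    field
      obj : Obj
      i₁ : A ⇒ obj
      i₂ : B ⇒ obj
      isCoproduct : IsCoproduct i₁ i₂

  IsEqualiser : ∀ {X Z E} → X ⇒ Z → X ⇒ Z → E ⇒ X → Set (o ⊔ ℓ ⊔ e)
  IsEqualiser {X} {Z} {E} f g m =
    (f ∘ m ≈ g ∘ m) ×
    (∀ {W} (h : W ⇒ X) → f ∘ h ≈ g ∘ h →
       Σ (W ⇒ E) λ k → (m ∘ k ≈ h) × (∀ (k' : W ⇒ E) → m ∘ k' ≈ h → k' ≈ k))

  IsWeakEqualiser : ∀ {X Z E} → X ⇒ Z → X ⇒ Z → E ⇒ X → Set (o ⊔ ℓ ⊔ e)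
  IsWeakEqualiser {X} {Z} {E} f g m =
    (f ∘ m ≈ g ∘ m) ×
    (∀ {W} (h : W ⇒ X) → f ∘ h ≈ g ∘ h → Σ (W ⇒ E) λ k → m ∘ k ≈ h)

  IsCoequaliser : ∀ {X Z Q} → X ⇒ Z → X ⇒ Z → Z ⇒ Q → Set (o ⊔ ℓ ⊔ e)
  IsCoequaliser {X} {Z} {Q} f g q =
    (q ∘ f ≈ q ∘ g) ×
    (∀ {W} (h : Z ⇒ W) → h ∘ f ≈ h ∘ g →
       Σ (Q ⇒ W) λ k → (k ∘ q ≈ h) × (∀ (k' : Q ⇒ W) → k' ∘ q ≈ h → k' ≈ k))

  IsPullback : ∀ {A B Z P} → P ⇒ A → P ⇒ B → A ⇒ Z → B ⇒ Z → Set (o ⊔ ℓ ⊔ e)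
  IsPullback {A} {B} {Z} {P} p₁ p₂ u v =
    (u ∘ p₁ ≈ v ∘ p₂) ×
    (∀ {W} (a : W ⇒ A) (b : W ⇒ B) → u ∘ a ≈ v ∘ b →
       Σ (W ⇒ P) λ k → (p₁ ∘ k ≈ a) × (p₂ ∘ k ≈ b) ×
         (∀ (k' : W ⇒ P) → p₁ ∘ k' ≈ a → p₂ ∘ k' ≈ b → k' ≈ k))

  IsWeakPullback : ∀ {A B Z P} → P ⇒ A → P ⇒ B → A ⇒ Z → B ⇒ Z → Set (o ⊔ ℓ ⊔ e)
  IsWeakPullback {A} {B} {Z} {P} p₁ p₂ u v =
    (u ∘ p₁ ≈ v ∘ p₂) ×
    (∀ {W} (a : W ⇒ A) (b : W ⇒ B) → u ∘ a ≈ v ∘ b →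
       Σ (W ⇒ P) λ k → (p₁ ∘ k ≈ a) × (p₂ ∘ k ≈ b))

  record Equaliser {X Z} (f g : X ⇒ Z) : Set (o ⊔ ℓ ⊔ e) where
    field
      obj : Obj
      arr : obj ⇒ X
      isEqualiser : IsEqualiser f g arr

  record WeakEqualiser {X Z} (f g : X ⇒ Z) : Set (o ⊔ ℓ ⊔ e) where
    field
      obj : Obj
      arr : obj ⇒ X
      isWeakEqualiser : IsWeakEqualiser f g arr

  record Coequaliser {X Z} (f g : X ⇒ Z) : Set (o ⊔ ℓ ⊔ e) where
    field
      obj : Obj
      arr : Z ⇒ obj
      isCoequaliser : IsCoequaliser f g arr

  record FiniteProducts : Set (o ⊔ ℓ ⊔ e) where
    field
      terminal : Terminal
      product  : ∀ A B → Product A B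

  record FiniteSums : Set (o ⊔ ℓ ⊔ e) where
    field
      initial   : Initial
      coproduct : ∀ A B → Coproduct A B

  WeakEqualisers : Set (o ⊔ ℓ ⊔ e)
  WeakEqualisers = ∀ {X Z} (f g : X ⇒ Z) → WeakEqualiser f g

  record FiniteLimits : Set (o ⊔ ℓ ⊔ e) where
    field
      terminal  : Terminal
      product   : ∀ A B → Product A B
      equaliser : ∀ {X Z} (f g : X ⇒ Z) → Equaliser f g

  record FiniteColimits : Set (o ⊔ ℓ ⊔ e) where
    field
      initial     : Initial
      coproduct   : ∀ A B → Coproduct A B
      coequaliser : ∀ {X Z} (f g : X ⇒ Z) → Coequaliser f g

module ProductOps {o ℓ e} (C : Category o ℓ e)
                  (product : ∀ A B → Notions.Product C A B) where
  open Category C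
  open Notions C

  infixr 7 _×ₒ_
  _×ₒ_ : Obj → Obj → Obj
  A ×ₒ B = Product.obj (product A B)

  π₁ : ∀ {A B} → A ×ₒ B ⇒ A
  π₁ {A} {B} = Product.π₁ (product A B)

  π₂ : ∀ {A B} → A ×ₒ B ⇒ B
  π₂ {A} {B} = Product.π₂ (product A B)

  ⟨_,_⟩ : ∀ {A B W} → W ⇒ A → W ⇒ B → W ⇒ A ×ₒ B
  ⟨_,_⟩ {A} {B} f g = proj₁ (Product.isProduct (product A B) f g)

  ⟪_,_,_⟫ : ∀ {J X Y W} → W ⇒ J → W ⇒ X → W ⇒ Y → W ⇒ J ×ₒ (X ×ₒ Y)
  ⟪ j , x , y ⟫ = ⟨ j , ⟨ x , y ⟩ ⟩

  project₁ : ∀ {A B W} {f : W ⇒ A} {g : W ⇒ B} → π₁ ∘ ⟨ f , g ⟩ ≈ f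
  project₁ {A} {B} {W} {f} {g} = proj₁ (proj₂ (Product.isProduct (product A B) f g))

  project₂ : ∀ {A B W} {f : W ⇒ A} {g : W ⇒ B} → π₂ ∘ ⟨ f , g ⟩ ≈ g
  project₂ {A} {B} {W} {f} {g} = proj₁ (proj₂ (proj₂ (Product.isProduct (product A B) f g)))

  unique : ∀ {A B W} {f : W ⇒ A} {g : W ⇒ B} {h : W ⇒ A ×ₒ B} →
           π₁ ∘ h ≈ f → π₂ ∘ h ≈ g → h ≈ ⟨ f , g ⟩
  unique {A} {B} {W} {f} {g} {h} p q =
    proj₂ (proj₂ (proj₂ (Product.isProduct (product A B) f g))) h p q

  ⟨⟩∘ : ∀ {A B V W} {f : W ⇒ A} {g : W ⇒ B} {h : V ⇒ W} →
        ⟨ f , g ⟩ ∘ h ≈ ⟨ f ∘ h , g ∘ h ⟩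
  ⟨⟩∘ = unique (≈trans (≈sym assoc) (∘-resp-≈ project₁ ≈refl))
               (≈trans (≈sym assoc) (∘-resp-≈ project₂ ≈refl))

  ⟨⟩-cong : ∀ {A B W} {f f' : W ⇒ A} {g g' : W ⇒ B} →
            f ≈ f' → g ≈ g' → ⟨ f , g ⟩ ≈ ⟨ f' , g' ⟩
  ⟨⟩-cong p q = unique (≈trans project₁ p) (≈trans project₂ q)

  _⊗_ : ∀ {A B} → A ⇒ B → A ⇒ B → A ×ₒ A ⇒ B ×ₒ B
  f ⊗ g = ⟨ f ∘ π₁ , g ∘ π₂ ⟩

  ⊗-⟨⟩ : ∀ {A B W} {g : A ⇒ B} {a b : W ⇒ A} → (g ⊗ g) ∘ ⟨ a , b ⟩ ≈ ⟨ g ∘ a , g ∘ b ⟩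
  ⊗-⟨⟩ = ≈trans ⟨⟩∘ (⟨⟩-cong (≈trans assoc (∘-resp-≈ ≈refl project₁))
                             (≈trans assoc (∘-resp-≈ ≈refl project₂)))

  id⊗id : ∀ {A} → (id {A}) ⊗ id ≈ id
  id⊗id = ≈sym (unique (≈trans identityʳ (≈sym identityˡ))
                       (≈trans identityʳ (≈sym identityˡ)))

  ⊗∘⊗ : ∀ {A B D} {f : A ⇒ B} {g : B ⇒ D} → (g ⊗ g) ∘ (f ⊗ f) ≈ (g ∘ f) ⊗ (g ∘ f)
  ⊗∘⊗ = ≈trans ⊗-⟨⟩ (⟨⟩-cong (≈sym assoc) (≈sym assoc))

  proj-eq₁ : ∀ {A B V W} {s : V ⇒ A ×ₒ B} {h : W ⇒ V} {a : W ⇒ A} {b : W ⇒ B} →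
             s ∘ h ≈ ⟨ a , b ⟩ → (π₁ ∘ s) ∘ h ≈ a
  proj-eq₁ eq = ≈trans assoc (≈trans (∘-resp-≈ ≈refl eq) project₁)

  proj-eq₂ : ∀ {A B V W} {s : V ⇒ A ×ₒ B} {h : W ⇒ V} {a : W ⇒ A} {b : W ⇒ B} →
             s ∘ h ≈ ⟨ a , b ⟩ → (π₂ ∘ s) ∘ h ≈ b
  proj-eq₂ eq = ≈trans assoc (≈trans (∘-resp-≈ ≈refl eq) project₂)

module Elements {o ℓ e} (C : Category o ℓ e)
                (T : Notions.Terminal C)
                (product : ∀ A B → Notions.Product C A B) where
  open Category C
  open Notions C
  open ProductOps C product
  open Terminal T renaming (⊤ to 𝟙)

  Elem : Obj → Set ℓ
  Elem X = 𝟙 ⇒ X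

  _∈[_] : ∀ {X Y} → Elem Y → X ⇒ Y → Set (ℓ ⊔ e)
  _∈[_] {X} y f = Σ (Elem X) λ x → f ∘ x ≈ y

  Surjective : ∀ {X Y} → X ⇒ Y → Set (ℓ ⊔ e)
  Surjective {X} {Y} f = ∀ (y : Elem Y) → y ∈[ f ]

  ChoiceObject : Obj → Set (o ⊔ ℓ ⊔ e)
  ChoiceObject Y = ∀ {X} (p : X ⇒ Y) → Surjective p → Σ (Y ⇒ X) λ s → p ∘ s ≈ id

  IndecomposableTerminal : Set (o ⊔ ℓ ⊔ e)
  IndecomposableTerminal =
    ∀ {X Y S} (i : X ⇒ S) (j : Y ⇒ S) → IsCoproduct i j →
      ∀ (z : Elem S) → (z ∈[ i ]) ⊎ (z ∈[ j ])

  NonDegenerate : Initial → Set (ℓ ⊔ e)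
  NonDegenerate I = ¬ (𝟙 ≅ Initial.⊥ I)

  record WeakNNO : Set (o ⊔ ℓ ⊔ e) where
    field
      N : Obj
      zero : Elem N
      succ : N ⇒ N
      rec : ∀ {X} (x : Elem X) (f : X ⇒ X) →
            Σ (N ⇒ X) λ g → (g ∘ zero ≈ x) × (g ∘ succ ≈ f ∘ g)

  record NNO : Set (o ⊔ ℓ ⊔ e) where
    field
      N : Obj
      zero : Elem N
      succ : N ⇒ N
      rec : ∀ {X} (x : Elem X) (f : X ⇒ X) →
            Σ (N ⇒ X) λ g → (g ∘ zero ≈ x) × (g ∘ succ ≈ f ∘ g) ×
              (∀ (g' : N ⇒ X) → g' ∘ zero ≈ x → g' ∘ succ ≈ f ∘ g' → g' ≈ g)

  IsFamily : ∀ {I X Y J R} (f : X ⇒ I) (g : Y ⇒ X) → J ⇒ I → R ⇒ J ×ₒ (X ×ₒ Y) →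
             Set (ℓ ⊔ e)
  IsFamily {I} {X} {Y} {J} f g h r =
    (∀ (j : Elem J) (x : Elem X) (y : Elem Y) → ⟪ j , x , y ⟫ ∈[ r ] → g ∘ y ≈ x) ×
    (∀ (j : Elem J) (x : Elem X) →
       (f ∘ x ≈ h ∘ j) iff (Σ (Elem Y) λ y → ⟪ j , x , y ⟫ ∈[ r ]))

  IsPseudoRel : ∀ {I X Y R} (f : X ⇒ I) (g : Y ⇒ X) → Elem I → R ⇒ X ×ₒ Y →
                Set (ℓ ⊔ e)
  IsPseudoRel {I} {X} {Y} f g i r =
    (∀ (x : Elem X) (y : Elem Y) → ⟨ x , y ⟩ ∈[ r ] → g ∘ y ≈ x) ×
    (∀ (x : Elem X) → (f ∘ x ≈ i) iff (Σ (Elem Y) λ y → ⟨ x , y ⟩ ∈[ r ]))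

  record FullFamily {I X Y} (f : X ⇒ I) (g : Y ⇒ X) : Set (o ⊔ ℓ ⊔ e) where
    field
      F : Obj
      φ : F ⇒ I
      P : Obj
      α : P ⇒ F ×ₒ (X ×ₒ Y)
      isFamily : IsFamily f g φ α
      full : ∀ (i : Elem I) {R} (r : R ⇒ X ×ₒ Y) → IsPseudoRel f g i r →
             Σ (Elem F) λ c → (φ ∘ c ≈ i) ×
               (∀ (x : Elem X) (y : Elem Y) → ⟪ c , x , y ⟫ ∈[ α ] → ⟨ x , y ⟩ ∈[ r ])

  ClosedForPseudoRelations : Set (o ⊔ ℓ ⊔ e)
  ClosedForPseudoRelations = ∀ {I X Y} (g : Y ⇒ X) (f : X ⇒ I) → FullFamily f g

  FunctionalRel : ∀ {X Y R} → R ⇒ X ×ₒ Y → Set (ℓ ⊔ e)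
  FunctionalRel {X} {Y} r =
    ∀ (x x' : Elem X) (y y' : Elem Y) →
      ⟨ x , y ⟩ ∈[ r ] → ⟨ x' , y' ⟩ ∈[ r ] → x ≈ x' → y ≈ y'

  FunctionalFamily : ∀ {J X Y P} → P ⇒ J ×ₒ (X ×ₒ Y) → Set (ℓ ⊔ e)
  FunctionalFamily {J} {X} {Y} α =
    ∀ (j : Elem J) (x x' : Elem X) (y y' : Elem Y) →
      ⟪ j , x , y ⟫ ∈[ α ] → ⟪ j , x' , y' ⟫ ∈[ α ] → x ≈ x' → y ≈ y'

  record UniversalDependentProduct {I X Y} (f : X ⇒ I) (g : Y ⇒ X) : Set (o ⊔ ℓ ⊔ e) where
    field
      F : Obj
      φ : F ⇒ I
      P : Obj
      α : P ⇒ F ×ₒ (X ×ₒ Y)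
      α-mono : Mono α
      isFamily : IsFamily f g φ α
      functional : FunctionalFamily α
      universal : ∀ (i : Elem I) {R} (r : R ⇒ X ×ₒ Y) → Mono r →
                  IsPseudoRel f g i r → FunctionalRel r →
                  Σ (Elem F) λ c →
                    ((φ ∘ c ≈ i) ×
                     (∀ (x : Elem X) (y : Elem Y) → (⟪ c , x , y ⟫ ∈[ α ]) iff (⟨ x , y ⟩ ∈[ r ]))) ×
                    (∀ (c' : Elem F) → φ ∘ c' ≈ i →
                       (∀ (x : Elem X) (y : Elem Y) → (⟪ c' , x , y ⟫ ∈[ α ]) iff (⟨ x , y ⟩ ∈[ r ])) →
                       c' ≈ c)

  record EquivalenceRelation (X : Obj) : Set (o ⊔ ℓ ⊔ e) where
    field
      R : Obj
      r : R ⇒ X ×ₒ X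
      r-mono : Mono r
      ρ : X ⇒ R
      ρ-eq : r ∘ ρ ≈ ⟨ id , id ⟩
      σ : R ⇒ R
      σ-eq : r ∘ σ ≈ ⟨ π₂ ∘ r , π₁ ∘ r ⟩
      τ : ∀ {Q} (p₁ p₂ : Q ⇒ R) → IsPullback p₁ p₂ (π₂ ∘ r) (π₁ ∘ r) →
          Σ (Q ⇒ R) λ t → r ∘ t ≈ ⟨ (π₁ ∘ r) ∘ p₁ , (π₂ ∘ r) ∘ p₂ ⟩

  IsKernelPair : ∀ {X R} → R ⇒ X → R ⇒ X → Set (o ⊔ ℓ ⊔ e)
  IsKernelPair {X} r₁ r₂ = Σ Obj λ Y → Σ (X ⇒ Y) λ f → IsPullback r₁ r₂ f f

module Lextensive {o ℓ e} (C : Category o ℓ e)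
                  (fp : Notions.FiniteProducts C) (fs : Notions.FiniteSums C) where
  open Category C
  open Notions C
  open FiniteProducts fp
  open FiniteSums fs
  open ProductOps C product
  open Initial initial renaming (⊥ to 𝟘)

  _+ₒ_ : Obj → Obj → Obj
  A +ₒ B = Coproduct.obj (coproduct A B)

  i₁ : ∀ {A B} → A ⇒ A +ₒ B
  i₁ {A} {B} = Coproduct.i₁ (coproduct A B)

  i₂ : ∀ {A B} → B ⇒ A +ₒ B
  i₂ {A} {B} = Coproduct.i₂ (coproduct A B)

  [_,_] : ∀ {A B W} → A ⇒ W → B ⇒ W → A +ₒ B ⇒ W
  [_,_] {A} {B} f g = proj₁ (Coproduct.isCoproduct (coproduct A B) f g)

  _⊕_ : ∀ {A B A' B'} → A ⇒ A' → B ⇒ B' → A +ₒ B ⇒ A' +ₒ B'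
  f ⊕ g = [ i₁ ∘ f , i₂ ∘ g ]

  DisjointSums : Set (o ⊔ ℓ ⊔ e)
  DisjointSums = ∀ A B → IsPullback (¡ {A}) (¡ {B}) (i₁ {A} {B}) (i₂ {A} {B})

  StrictInitial : Set (o ⊔ ℓ ⊔ e)
  StrictInitial = ∀ {X} (f : X ⇒ 𝟘) → IsIso f

  distr : ∀ {X Y Z} → (X ×ₒ Y) +ₒ (X ×ₒ Z) ⇒ X ×ₒ (Y +ₒ Z)
  distr = [ ⟨ π₁ , i₁ ∘ π₂ ⟩ , ⟨ π₁ , i₂ ∘ π₂ ⟩ ]

  Distributive : Set (o ⊔ ℓ ⊔ e)
  Distributive = ∀ {X Y Z} → IsIso (distr {X} {Y} {Z})

  WeakEqualisersStable : Set (o ⊔ ℓ ⊔ e)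
  WeakEqualisersStable =
    ∀ {X Y Z EX EY} (f g : X ⇒ Z) (f' g' : Y ⇒ Z) (eX : EX ⇒ X) (eY : EY ⇒ Y) →
      IsWeakEqualiser f g eX → IsWeakEqualiser f' g' eY →
      IsWeakEqualiser [ f , f' ] [ g , g' ] (eX ⊕ eY)

  record WeaklyLextensive : Set (o ⊔ ℓ ⊔ e) where
    field
      disjoint      : DisjointSums
      strictInitial : StrictInitial
      distributive  : Distributive
      weqStable     : WeakEqualisersStable

module ExactCompletion {o ℓ e} (C : Category o ℓ e)
                       (fp : Notions.FiniteProducts C)
                       (we : Notions.WeakEqualisers C) where
  open Category C
  open Notions C
  open FiniteProducts fp
  open ProductOps C product

  -- pseudo-equivalence relations
  record PER : Set (o ⊔ ℓ ⊔ e) where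
    field
      X : Obj
      R : Obj
      r : R ⇒ X ×ₒ X
      ρ : X ⇒ R
      ρ-eq : r ∘ ρ ≈ ⟨ id , id ⟩
      σ : R ⇒ R
      σ-eq : r ∘ σ ≈ ⟨ π₂ ∘ r , π₁ ∘ r ⟩
      τ : ∀ {Q} (p₁ p₂ : Q ⇒ R) → IsWeakPullback p₁ p₂ (π₂ ∘ r) (π₁ ∘ r) →
          Σ (Q ⇒ R) λ t → r ∘ t ≈ ⟨ (π₁ ∘ r) ∘ p₁ , (π₂ ∘ r) ∘ p₂ ⟩

  open PER

  -- representatives of arrows: f : X → Y admitting some f̂
  record PERHom (A B : PER) : Set (ℓ ⊔ e) where
    constructor perHom
    field
      f : X A ⇒ X B
      f̂ : R A ⇒ R B
      comm : r B ∘ f̂ ≈ (f ⊗ f) ∘ r A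

  open PERHom

  _∼_ : ∀ {A B} → PERHom A B → PERHom A B → Set (ℓ ⊔ e)
  _∼_ {A} {B} u v = Σ (X A ⇒ R B) λ h → r B ∘ h ≈ ⟨ f u , f v ⟩

  wpb : ∀ {P Q Z} (u : P ⇒ Z) (v : Q ⇒ Z) →
        Σ Obj λ W → Σ (W ⇒ P) λ p₁ → Σ (W ⇒ Q) λ p₂ → IsWeakPullback p₁ p₂ u v
  wpb u v = obj , π₁ ∘ arr , π₂ ∘ arr , comm' , univ
    where
      open WeakEqualiser (we (u ∘ π₁) (v ∘ π₂))
      comm' = ≈trans (≈sym assoc) (≈trans (proj₁ isWeakEqualiser) assoc)
      univ : ∀ {W} (a : W ⇒ _) (b : W ⇒ _) → u ∘ a ≈ v ∘ b →
             Σ (W ⇒ obj) λ k → ((π₁ ∘ arr) ∘ k ≈ a) × ((π₂ ∘ arr) ∘ k ≈ b)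
      univ a b eq =
        let eq' = ≈trans assoc (≈trans (∘-resp-≈ ≈refl project₁)
                   (≈trans eq (≈sym (≈trans assoc (∘-resp-≈ ≈refl project₂)))))
            k , ek = proj₂ isWeakEqualiser ⟨ a , b ⟩ eq'
        in k , ≈trans assoc (≈trans (∘-resp-≈ ≈refl ek) project₁)
             , ≈trans assoc (≈trans (∘-resp-≈ ≈refl ek) project₂)

  ≈⇒∼ : ∀ {A B} {u v : PERHom A B} → f u ≈ f v → u ∼ v
  ≈⇒∼ {A} {B} {u} {v} eq =
    ρ B ∘ f u ,
    ≈trans (≈sym assoc) (≈trans (∘-resp-≈ (ρ-eq B) ≈refl)
      (≈trans ⟨⟩∘ (⟨⟩-cong identityˡ (≈trans identityˡ eq))))

  ∼-sym : ∀ {A B} {u v : PERHom A B} → u ∼ v → v ∼ u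
  ∼-sym {A} {B} {u} {v} (h , eq) =
    σ B ∘ h ,
    ≈trans (≈sym assoc) (≈trans (∘-resp-≈ (σ-eq B) ≈refl)
      (≈trans ⟨⟩∘ (⟨⟩-cong (proj-eq₂ eq) (proj-eq₁ eq))))

  ∼-trans : ∀ {A B} {u v w : PERHom A B} → u ∼ v → v ∼ w → u ∼ w
  ∼-trans {A} {B} {u} {v} {w} (h₁ , eq₁) (h₂ , eq₂) =
    let W , p₁ , p₂ , isWP = wpb (π₂ ∘ r B) (π₁ ∘ r B)
        q , q₁ , q₂ = proj₂ isWP h₁ h₂ (≈trans (proj-eq₂ eq₁) (≈sym (proj-eq₁ eq₂)))
        t , teq = τ B p₁ p₂ isWP
    in t ∘ q ,
       ≈trans (≈sym assoc) (≈trans (∘-resp-≈ teq ≈refl) (≈trans ⟨⟩∘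
         (⟨⟩-cong (≈trans assoc (≈trans (∘-resp-≈ ≈refl q₁) (proj-eq₁ eq₁)))
                  (≈trans assoc (≈trans (∘-resp-≈ ≈refl q₂) (proj-eq₂ eq₂))))))

  idH : ∀ {A} → PERHom A A
  idH {A} = perHom id id
    (≈trans identityʳ (≈sym (≈trans (∘-resp-≈ id⊗id ≈refl) identityˡ)))

  _∘H_ : ∀ {A B D} → PERHom B D → PERHom A B → PERHom A D
  _∘H_ {A} {B} {D} v u = perHom (f v ∘ f u) (f̂ v ∘ f̂ u)
    (≈trans (≈sym assoc) (≈trans (∘-resp-≈ (comm v) ≈refl) (≈trans assoc
      (≈trans (∘-resp-≈ ≈refl (comm u)) (≈trans (≈sym assoc)
        (∘-resp-≈ ⊗∘⊗ ≈refl))))))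

  ∘H-resp : ∀ {A B D} {v v' : PERHom B D} {u u' : PERHom A B} →
            v ∼ v' → u ∼ u' → (v ∘H u) ∼ (v' ∘H u')
  ∘H-resp {A} {B} {D} {v} {v'} {u} {u'} (k , keq) (h , heq) =
    ∼-trans {u = v ∘H u} {v = v ∘H u'} {w = v' ∘H u'}
      (f̂ v ∘ h ,
        ≈trans (≈sym assoc) (≈trans (∘-resp-≈ (comm v) ≈refl) (≈trans assoc
          (≈trans (∘-resp-≈ ≈refl heq) ⊗-⟨⟩))))
      (k ∘ f u' ,
        ≈trans (≈sym assoc) (≈trans (∘-resp-≈ keq ≈refl) ⟨⟩∘))

  Cex : Category (o ⊔ ℓ ⊔ e) (ℓ ⊔ e) (ℓ ⊔ e)
  Cex = record
    { Obj = PER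
    ; _⇒_ = PERHom
    ; _≈_ = _∼_
    ; id = idH
    ; _∘_ = _∘H_
    ; equiv = λ {A} {B} → record
        { refl = λ {u} → ≈⇒∼ {u = u} {v = u} ≈refl
        ; sym = λ {u} {v} → ∼-sym {u = u} {v = v}
        ; trans = λ {u} {v} {w} → ∼-trans {u = u} {v = v} {w = w} }
    ; ∘-resp-≈ = λ {A} {B} {D} {v} {v'} {u} {u'} → ∘H-resp {v = v} {v'} {u} {u'}
    ; assoc = λ {A} {B} {D} {E} {u} {v} {w} →
        ≈⇒∼ {u = (w ∘H v) ∘H u} {v = w ∘H (v ∘H u)} assoc
    ; identityˡ = λ {A} {B} {u} → ≈⇒∼ {u = idH ∘H u} {v = u} identityˡ
    ; identityʳ = λ {A} {B} {u} → ≈⇒∼ {u = u ∘H idH} {v = u} identityʳ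
    }

module CETCSAxioms {o ℓ e} (E : Category o ℓ e)
                   (L : Notions.FiniteLimits E) (K : Notions.FiniteColimits E) where
  open Category E
  open Notions E
  open FiniteLimits L
  open FiniteColimits K
  open ProductOps E product
  open Elements E terminal product
  open Terminal terminal renaming (⊤ to 𝟙)
  open Initial initial renaming (⊥ to 𝟘)

  record Axioms : Set (o ⊔ ℓ ⊔ e) where
    field
      -- (C1) is provided by L and K
      -- (C2) universal dependent products
      C2 : ∀ {I X Y} (g : Y ⇒ X) (f : X ⇒ I) → UniversalDependentProduct f g
      C3 : NNO
      C4-strong : ∀ {X Y} (f : X ⇒ Y) →
                  (∀ (y : Elem Y) → Σ (Elem X) λ x → (f ∘ x ≈ y) ×
                     (∀ (x' : Elem X) → f ∘ x' ≈ y → x' ≈ x)) →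
                  IsIso f
      C4-separating : ∀ {X Y} (f g : X ⇒ Y) → (∀ (x : Elem X) → f ∘ x ≈ g ∘ x) → f ≈ g
      C5 : ∀ X → Σ Obj λ Y → Σ (Y ⇒ X) λ p → ChoiceObject Y × Surjective p
      C6 : ¬ Elem 𝟘
      C7 : IndecomposableTerminal
      C8 : ∀ {S} (i j : 𝟙 ⇒ S) → IsCoproduct i j → ¬ (i ≈ j)
      C9 : ∀ {X Y} (f : X ⇒ Y) → Σ Obj λ Z → Σ (X ⇒ Z) λ p → Σ (Z ⇒ Y) λ m →
             Surjective p × Mono m × (m ∘ p ≈ f)
      C10 : ∀ {X} (Rel : EquivalenceRelation X) →
            IsKernelPair (π₁ ∘ EquivalenceRelation.r Rel) (π₂ ∘ EquivalenceRelation.r Rel)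

record ModelOfCETCS {o ℓ e} (E : Category o ℓ e) : Set (o ⊔ ℓ ⊔ e) where
  field
    finiteLimits   : Notions.FiniteLimits E
    finiteColimits : Notions.FiniteColimits E
    axioms         : CETCSAxioms.Axioms E finiteLimits finiteColimits

-- Since every object of C is a choice object, an arrow f factors through r as
-- soon as each value f x lies in the image of r. Hence equality and existence of
-- arrows, in C and in its exact completion, can be tested on global elements,
-- and each axiom of CETCS becomes a statement about elements, provided the
-- predicates involved are images of arrows of C. Such predicates are closed under
-- equality, conjunction and ∃ (weak limits), disjunction (indecomposability of 1),
-- and ∀ and implication (full families).
--
-- Coequalisers are quotients by finite chains, coded in a weak exponential; a
-- natural numbers object is cut out of the weak one as the elements fixed by all
-- its algebra endomorphisms. For dependent products, a full family over the
-- fibres of f and g up to equality is cut down to its extensional members.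

module Submission where

open import Defs
open import Level using (Level; _⊔_)
open import Data.Product using (Σ; _×_; _,_; proj₁; proj₂)
open import Data.Sum using (_⊎_; inj₁; inj₂)
open import Data.Empty using (⊥-elim)
open import Relation.Nullary using (¬_)
open import Relation.Binary using (IsEquivalence)

-- The logic obtained in C quantifies over the elements of an object, never over predicates. So the
-- equivalence relation generated by a pair of arrows cannot be had as an intersection, nor the
-- natural numbers as the elements satisfying all inductive predicates. Both are reached by
-- quantifying over names of arrows instead, which is what the weak exponential is for.
--
-- A full family answers a given relation only with an index of some smaller relation over the same
-- domain. When the given relation is single-valued, a total relation contained in it must coincide
-- with it; this is how arrows receive names and how dependent products become universal.

module Points {o ℓ e} (C : Category o ℓ e)
    (fp : Notions.FiniteProducts C)
    (we : Notions.WeakEqualisers C)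
    (choice : ∀ (X : Category.Obj C) →
      Elements.ChoiceObject C (Notions.FiniteProducts.terminal fp)
        (Notions.FiniteProducts.product fp) X)
    where
  open Category C public
  open Notions C public
  open FiniteProducts fp public
  open ProductOps C product public
  open Elements C terminal product public
  open Terminal terminal public renaming (⊤ to 𝟙)

  infixr 5 _⨾_
  _⨾_ : ∀ {A B} {f g h : A ⇒ B} → f ≈ g → g ≈ h → f ≈ h
  _⨾_ = ≈trans

  infix 6 refl⟩∘⟨_ _⟩∘⟨refl
  refl⟩∘⟨_ : ∀ {A B D} {f : B ⇒ D} {g h : A ⇒ B} → g ≈ h → f ∘ g ≈ f ∘ h
  refl⟩∘⟨ p = ∘-resp-≈ ≈refl p

  _⟩∘⟨refl : ∀ {A B D} {f g : B ⇒ D} {h : A ⇒ B} → f ≈ g → f ∘ h ≈ g ∘ h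
  p ⟩∘⟨refl = ∘-resp-≈ p ≈refl

  pullˡ : ∀ {A B D V} {f : A ⇒ B} {g : B ⇒ D} {h : D ⇒ V} {k : B ⇒ V} →
          h ∘ g ≈ k → h ∘ (g ∘ f) ≈ k ∘ f
  pullˡ p = ≈sym assoc ⨾ p ⟩∘⟨refl

  pullʳ : ∀ {A B D V} {f : A ⇒ B} {g : B ⇒ D} {h : D ⇒ V} {k : A ⇒ D} →
          g ∘ f ≈ k → (h ∘ g) ∘ f ≈ h ∘ k
  pullʳ p = assoc ⨾ refl⟩∘⟨ p

  !-unique : ∀ {X} {f g : X ⇒ 𝟙} → f ≈ g
  !-unique {X} {f} {g} =
    proj₂ (Terminal.isTerminal terminal X) f ⨾ ≈sym (proj₂ (Terminal.isTerminal terminal X) g)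

  const∘ : ∀ {X Y} {z : Elem Y} {f : X ⇒ 𝟙} {x : Elem X} → (z ∘ f) ∘ x ≈ z
  const∘ = pullʳ !-unique ⨾ identityʳ

  η : ∀ {A B W} {p : W ⇒ A ×ₒ B} → p ≈ ⟨ π₁ ∘ p , π₂ ∘ p ⟩
  η = unique ≈refl ≈refl

  ⟨⟩-inj₁ : ∀ {A B W} {a a' : W ⇒ A} {b b' : W ⇒ B} → ⟨ a , b ⟩ ≈ ⟨ a' , b' ⟩ → a ≈ a'
  ⟨⟩-inj₁ p = ≈sym project₁ ⨾ refl⟩∘⟨ p ⨾ project₁

  ⟨⟩-inj₂ : ∀ {A B W} {a a' : W ⇒ A} {b b' : W ⇒ B} → ⟨ a , b ⟩ ≈ ⟨ a' , b' ⟩ → b ≈ b'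
  ⟨⟩-inj₂ p = ≈sym project₂ ⨾ refl⟩∘⟨ p ⨾ project₂

  ∈-resp : ∀ {X Y} {r : X ⇒ Y} {y y' : Elem Y} → y ≈ y' → y ∈[ r ] → y' ∈[ r ]
  ∈-resp p (w , q) = w , q ⨾ p

  weakPullback : ∀ {A B Z} (u : A ⇒ Z) (v : B ⇒ Z) →
    Σ Obj λ W → Σ (W ⇒ A) λ p₁ → Σ (W ⇒ B) λ p₂ → IsWeakPullback p₁ p₂ u v
  weakPullback = ExactCompletion.wpb C fp we

  abstract
    -- If every value of `f` lies in the image of `r`, the leg to `X` of a weak pullback of `f` and
    -- `r` is surjective; a section of it followed by the other leg is the factorisation.
    factor : ∀ {X Y R} (r : R ⇒ Y) (f : X ⇒ Y) → (∀ (x : Elem X) → (f ∘ x) ∈[ r ]) →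
             Σ (X ⇒ R) λ h → r ∘ h ≈ f
    factor {X} r f total =
      let W , p₁ , p₂ , commutes , universal = weakPullback f r
          s , sec = choice X p₁ λ x →
            let w , rw≈fx = total x
                k , k₁ , _ = universal x w (≈sym rw≈fx)
            in k , k₁
      in p₂ ∘ s , (pullˡ (≈sym commutes) ⨾ pullʳ sec ⨾ identityʳ)

-- The logic of representable predicates on global elements.

module Logic {o ℓ e} (C : Category o ℓ e)
    (fp : Notions.FiniteProducts C)
    (we : Notions.WeakEqualisers C)
    (fs : Notions.FiniteSums C)
    (choice : ∀ (X : Category.Obj C) →
      Elements.ChoiceObject C (Notions.FiniteProducts.terminal fp)
        (Notions.FiniteProducts.product fp) X)
    (indec : Elements.IndecomposableTerminal C (Notions.FiniteProducts.terminal fp)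
      (Notions.FiniteProducts.product fp))
    (closed : Elements.ClosedForPseudoRelations C (Notions.FiniteProducts.terminal fp)
      (Notions.FiniteProducts.product fp))
    where
  open Points C fp we choice public
  open Lextensive C fp fs public using (_+ₒ_; i₁; i₂; [_,_])

  -- Predicates are stated on tuples of global elements, so that a derivation of
  -- Rep Γ P has the shape of the formula P.
  infixl 5 _▹_
  data Ctx : Set o where
    ⌈_⌉ : Obj → Ctx
    _▹_ : Ctx → Obj → Ctx

  ⌊_⌋ : Ctx → Obj
  ⌊ ⌈ X ⌉ ⌋ = X
  ⌊ Γ ▹ X ⌋ = ⌊ Γ ⌋ ×ₒ X

  Env : Ctx → Set ℓ
  Env ⌈ X ⌉ = Elem X
  Env (Γ ▹ X) = Env Γ × Elem X

  point : ∀ Γ → Env Γ → Elem ⌊ Γ ⌋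
  point ⌈ X ⌉ x = x
  point (Γ ▹ X) (γ , x) = ⟨ point Γ γ , x ⟩

  record Term (Γ : Ctx) {X : Obj} (t : Env Γ → Elem X) : Set (ℓ ⊔ e) where
    constructor term
    field
      arr  : ⌊ Γ ⌋ ⇒ X
      eval : ∀ γ → arr ∘ point Γ γ ≈ t γ

  here : ∀ {X} → Term ⌈ X ⌉ (λ x → x)
  here = term id λ _ → identityˡ

  v₀ : ∀ {Γ X} → Term (Γ ▹ X) proj₂
  v₀ = term π₂ λ _ → project₂

  ↑ : ∀ {Γ X Y} {t : Env Γ → Elem Y} → Term Γ t → Term (Γ ▹ X) (λ γ → t (proj₁ γ))
  ↑ (term arr eval) = term (arr ∘ π₁) λ { (γ , _) → pullʳ project₁ ⨾ eval γ }

  const : ∀ {Γ X} (z : Elem X) → Term Γ (λ _ → z)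
  const z = term (z ∘ !) λ _ → const∘

  infixr 9 _·_
  _·_ : ∀ {Γ X Y} {t : Env Γ → Elem X} (f : X ⇒ Y) → Term Γ t → Term Γ (λ γ → f ∘ t γ)
  f · term arr eval = term (f ∘ arr) λ γ → pullʳ (eval γ)

  ⟪_,_⟫ₜ : ∀ {Γ X Y} {t : Env Γ → Elem X} {u : Env Γ → Elem Y} →
           Term Γ t → Term Γ u → Term Γ (λ γ → ⟨ t γ , u γ ⟩)
  ⟪ term a p , term b q ⟫ₜ = term ⟨ a , b ⟩ λ γ → ⟨⟩∘ ⨾ ⟨⟩-cong (p γ) (q γ)

  -- Only inhabitation is recorded: `ext` need not be monic, and `to` and `from` need not be
  -- mutually inverse.
  record Rep (Γ : Ctx) {a} (P : Env Γ → Set a) : Set (o ⊔ ℓ ⊔ e ⊔ a) where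
    field
      {Ext} : Obj
      ext   : Ext ⇒ ⌊ Γ ⌋
      to    : ∀ γ → P γ → point Γ γ ∈[ ext ]
      from  : ∀ γ → point Γ γ ∈[ ext ] → P γ

    -- Membership in an image is invariant under `≈`, so congruence never has to be checked formula
    -- by formula.
    resp : ∀ {γ δ} → point Γ γ ≈ point Γ δ → P γ → P δ
    resp {γ} {δ} eq p = from δ (∈-resp eq (to γ p))
  open Rep

  private variable
    a b : Level
    Γ : Ctx

  infix 4 _≐_
  abstract
    _≐_ : ∀ {X} {t u : Env Γ → Elem X} → Term Γ t → Term Γ u → Rep Γ (λ γ → t γ ≈ u γ)
    term f p ≐ term g q = let open WeakEqualiser (we f g) in record
      { ext  = arr
      ; to   = λ γ eq → proj₂ isWeakEqualiser _ (p γ ⨾ eq ⨾ ≈sym (q γ))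
      ; from = λ { γ (w , eq) →
          ≈sym (p γ) ⨾ refl⟩∘⟨ (≈sym eq) ⨾ pullˡ (proj₁ isWeakEqualiser) ⨾ pullʳ eq ⨾ q γ }
      }

    mem : ∀ {X R} {t : Env Γ → Elem X} (r : R ⇒ X) → Term Γ t → Rep Γ (λ γ → t γ ∈[ r ])
    mem r (term f p) = let W , p₁ , p₂ , commutes , universal = weakPullback f r in record
      { ext  = p₁
      ; to   = λ { γ (w , eq) →
          let k , k₁ , _ = universal _ w (p γ ⨾ ≈sym eq) in k , k₁ }
      ; from = λ { γ (w , eq) →
          p₂ ∘ w , pullˡ (≈sym commutes) ⨾ pullʳ eq ⨾ p γ }
      }

    _⟨_⟩₁ : ∀ {X} {P : Elem X → Set a} {t : Env Γ → Elem X} →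
            Rep ⌈ X ⌉ P → Term Γ t → Rep Γ (λ γ → P (t γ))
    P ⟨ t ⟩₁ = let M = mem (ext P) t in record
      { ext  = ext M
      ; to   = λ γ p → to M γ (to P _ p)
      ; from = λ γ m → from P _ (from M γ m)
      }

    _⟨_,_⟩₂ : ∀ {X Y} {P : Elem X → Elem Y → Set a} {t : Env Γ → Elem X} {u : Env Γ → Elem Y} →
              Rep (⌈ X ⌉ ▹ Y) (λ (x , y) → P x y) → Term Γ t → Term Γ u →
              Rep Γ (λ γ → P (t γ) (u γ))
    P ⟨ t , u ⟩₂ = let M = mem (ext P) ⟪ t , u ⟫ₜ in record
      { ext  = ext M
      ; to   = λ γ p → to M γ (to P _ p)
      ; from = λ γ m → from P _ (from M γ m)
      }

  infixr 3 _∧_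
  abstract
    _∧_ : ∀ {P : Env Γ → Set a} {Q : Env Γ → Set b} →
          Rep Γ P → Rep Γ Q → Rep Γ (λ γ → P γ × Q γ)
    P ∧ Q = let W , p₁ , p₂ , commutes , universal = weakPullback (ext P) (ext Q) in record
      { ext  = ext P ∘ p₁
      ; to   = λ { γ (p , q) →
          let w , eq = to P γ p
              v , eq' = to Q γ q
              k , k₁ , _ = universal w v (eq ⨾ ≈sym eq')
          in k , pullʳ k₁ ⨾ eq }
      ; from = λ { γ (k , eq) →
          from P γ (p₁ ∘ k , ≈sym assoc ⨾ eq) ,
          from Q γ (p₂ ∘ k , pullˡ (≈sym commutes) ⨾ eq) }
      }

  [,]-i₁ : ∀ {A B W} {f : A ⇒ W} {g : B ⇒ W} → [ f , g ] ∘ i₁ ≈ f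
  [,]-i₁ {A} {B} {f = f} {g} =
    proj₁ (proj₂ (Coproduct.isCoproduct (FiniteSums.coproduct fs A B) f g))

  [,]-i₂ : ∀ {A B W} {f : A ⇒ W} {g : B ⇒ W} → [ f , g ] ∘ i₂ ≈ g
  [,]-i₂ {A} {B} {f = f} {g} =
    proj₁ (proj₂ (proj₂ (Coproduct.isCoproduct (FiniteSums.coproduct fs A B) f g)))

  +-elem : ∀ {A B} (z : Elem (A +ₒ B)) → (z ∈[ i₁ ]) ⊎ (z ∈[ i₂ ])
  +-elem {A} {B} = indec i₁ i₂ (Coproduct.isCoproduct (FiniteSums.coproduct fs A B))

  infixr 2 _∨_
  abstract
    _∨_ : ∀ {P : Env Γ → Set a} {Q : Env Γ → Set b} →
          Rep Γ P → Rep Γ Q → Rep Γ (λ γ → P γ ⊎ Q γ)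
    _∨_ {Γ = Γ} {P = P′} {Q = Q′} P Q = record
      { ext  = [ ext P , ext Q ]
      ; to   = λ
          { γ (inj₁ p) → let w , eq = to P γ p in i₁ ∘ w , pullˡ [,]-i₁ ⨾ eq
          ; γ (inj₂ q) → let w , eq = to Q γ q in i₂ ∘ w , pullˡ [,]-i₂ ⨾ eq }
      ; from = λ { γ (k , eq) → case γ k eq (+-elem k) }
      }
      where
      case : ∀ γ k → [ ext P , ext Q ] ∘ k ≈ point Γ γ → (k ∈[ i₁ ]) ⊎ (k ∈[ i₂ ]) → P′ γ ⊎ Q′ γ
      case γ k eq (inj₁ (w , eq')) =
        inj₁ (from P γ (w , ≈sym (pullˡ [,]-i₁) ⨾ refl⟩∘⟨ eq' ⨾ eq))
      case γ k eq (inj₂ (w , eq')) =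
        inj₂ (from Q γ (w , ≈sym (pullˡ [,]-i₂) ⨾ refl⟩∘⟨ eq' ⨾ eq))

    ∃̇ : ∀ X {P : Env (Γ ▹ X) → Set a} → Rep (Γ ▹ X) P → Rep Γ (λ γ → Σ (Elem X) λ x → P (γ , x))
    ∃̇ X P = record
      { ext  = π₁ ∘ ext P
      ; to   = λ { γ (x , p) → let w , eq = to P (γ , x) p in w , pullʳ eq ⨾ project₁ }
      ; from = λ { γ (w , eq) →
          π₂ ∘ (ext P ∘ w) , from P (γ , _) (w , η ⨾ ⟨⟩-cong (≈sym assoc ⨾ eq) ≈refl) }
      }

  -- The index of a full family is universal quantification along f.
  along : ∀ {I X Y} (g : Y ⇒ X) (f : X ⇒ I) (i : Elem I) →
          (∀ x → f ∘ x ≈ i → x ∈[ g ]) iff (i ∈[ FullFamily.φ (closed g f) ])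
  along {I} {X} {Y} g f i = onto , into
    where
    open FullFamily (closed g f)

    open WeakEqualiser (we (f ∘ g) (i ∘ !)) renaming (arr to fibre)

    section-of-fibre : ∀ {y} → f ∘ (g ∘ y) ≈ i → y ∈[ fibre ]
    section-of-fibre eq = proj₂ isWeakEqualiser _ (assoc ⨾ eq ⨾ ≈sym const∘)

    -- The graph of `g` cut down to the fibre of `f` over `i`. It is a pseudo-relation with domain
    -- index `i` exactly when `g` covers that fibre.
    graph : obj ⇒ X ×ₒ Y
    graph = ⟨ g ∘ fibre , fibre ⟩

    graph-to : ∀ x y → g ∘ y ≈ x → f ∘ x ≈ i → ⟨ x , y ⟩ ∈[ graph ]
    graph-to x y gy fx =
      let w , eq = section-of-fibre (refl⟩∘⟨ gy ⨾ fx)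
      in w , (⟨⟩∘ ⨾ ⟨⟩-cong (pullʳ eq ⨾ gy) eq)

    graph-from : ∀ x y → ⟨ x , y ⟩ ∈[ graph ] → (g ∘ y ≈ x) × (f ∘ x ≈ i)
    graph-from x y (w , eq) =
      let eq' = ≈sym ⟨⟩∘ ⨾ eq
          gy : g ∘ y ≈ x
          gy = refl⟩∘⟨ (≈sym (⟨⟩-inj₂ eq')) ⨾ ≈sym assoc ⨾ ⟨⟩-inj₁ eq'
      in gy , (refl⟩∘⟨ (≈sym (⟨⟩-inj₁ eq')) ⨾ refl⟩∘⟨ assoc ⨾ ≈sym assoc
               ⨾ pullˡ (proj₁ isWeakEqualiser) ⨾ assoc ⨾ const∘)

    onto : (∀ x → f ∘ x ≈ i → x ∈[ g ]) → i ∈[ φ ]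
    onto covers =
      let c , φc , _ = full i graph
            ( (λ x y m → proj₁ (graph-from x y m))
            , λ x → (λ fx → let y , gy = covers x fx in y , graph-to x y gy fx)
                  , λ { (y , m) → proj₂ (graph-from x y m) } )
      in c , φc

    into : i ∈[ φ ] → ∀ x → f ∘ x ≈ i → x ∈[ g ]
    into (c , φc) x fx =
      let y , m = proj₁ (proj₂ isFamily c x) (fx ⨾ ≈sym φc)
      in y , proj₁ isFamily c x y m

  abstract
    -- The fibre of `π₁` over `point Γ γ` consists of the pairs of that point with an arbitrary `x`;
    -- that `ext P` covers it means that `P` holds for all `x`.
    ∀̇ : ∀ X {P : Env (Γ ▹ X) → Set a} → Rep (Γ ▹ X) P → Rep Γ (λ γ → ∀ x → P (γ , x))
    ∀̇ {Γ = Γ} X P = record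
      { ext  = FullFamily.φ (closed (ext P) π₁)
      ; to   = λ γ p → proj₁ (along (ext P) π₁ (point Γ γ)) λ z eq →
          ∈-resp (⟨⟩-cong (≈sym eq) ≈refl ⨾ ≈sym η) (to P (γ , π₂ ∘ z) (p _))
      ; from = λ γ m x → from P (γ , x) (proj₂ (along (ext P) π₁ (point Γ γ)) m _ project₁)
      }

  infixr 1 _⊃_
  abstract
    -- The fibre of `ext P` over a point is inhabited just when `P` holds there, and `p₁` hits an
    -- element of this fibre just when `Q` holds there. Covering the fibre by `p₁` is thus the
    -- implication.
    _⊃_ : ∀ {P : Env Γ → Set a} {Q : Env Γ → Set b} →
          Rep Γ P → Rep Γ Q → Rep Γ (λ γ → P γ → Q γ)
    _⊃_ {Γ = Γ} P Q = let W , p₁ , p₂ , commutes , universal = weakPullback (ext P) (ext Q) in record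
      { ext  = FullFamily.φ (closed p₁ (ext P))
      ; to   = λ γ imp → proj₁ (along p₁ (ext P) (point Γ γ)) λ x eq →
          let v , eq' = to Q γ (imp (from P γ (x , eq)))
              k , k₁ , _ = universal x v (eq ⨾ ≈sym eq')
          in k , k₁
      ; from = λ γ m p →
          let x , eq = to P γ p
              k , k₁ = proj₂ (along p₁ (ext P) (point Γ γ)) m x eq
          in from Q γ (p₂ ∘ k , pullˡ (≈sym commutes) ⨾ pullʳ k₁ ⨾ eq)
      }

    -- Totality makes the first leg of `ext P` surjective, and a section of it carries a chosen
    -- value. The choice is one on elements up to `≈` only; respect for a coarser equality needs its
    -- own argument where it is wanted.
    choose : ∀ {X Y} {P : Elem X → Elem Y → Set a} → Rep (⌈ X ⌉ ▹ Y) (λ (x , y) → P x y) →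
             (∀ x → Σ (Elem Y) (P x)) → Σ (X ⇒ Y) λ f → ∀ x → P x (f ∘ x)
    choose P total =
      let s , sec = factor (π₁ ∘ ext P) id λ x →
            let y , p = total x
                w , eq = to P (x , y) p
            in w , pullʳ eq ⨾ project₁ ⨾ ≈sym identityˡ
      in π₂ ∘ (ext P ∘ s) , λ x → from P (x , _)
           (s ∘ x , η ⨾ ⟨⟩-cong (≈sym assoc ⨾ pullˡ sec ⨾ identityˡ) (refl⟩∘⟨ ≈sym assoc ⨾ ≈sym assoc))

  record WeakExponential (X Y : Obj) : Set (o ⊔ ℓ ⊔ e) where
    field
      {Fun} : Obj
      ev    : Fun ×ₒ X ⇒ Y
      name  : (h : X ⇒ Y) → Σ (Elem Fun) λ w → ∀ x → ev ∘ ⟨ w , x ⟩ ≈ h ∘ x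
  open WeakExponential

  -- The full family over `X × Y → X → 1` is indexed by total relations from `X` to `Y`, and choice
  -- selects one value at each index and argument. Fullness at the graph of `h` gives an index whose
  -- relation is contained in that graph, so the selected value can only be that of `h`.
  weakExponential : ∀ X Y → WeakExponential X Y
  weakExponential X Y = record
    { ev = π₂ ∘ chosenPoint
    ; name = λ h →
        -- A relation over `π₁` takes its values in `X × Y`, hence the doubled `id` in the graph of
        -- `h`.
        let w , _ , sub = full ! ⟨ id , ⟨ id , h ⟩ ⟩
              ( (λ x y (z , eq) → let eq' = ≈sym ⟨⟩∘ ⨾ eq in
                   refl⟩∘⟨ (≈sym (⟨⟩-inj₂ eq')) ⨾ pullˡ project₁ ⨾ ⟨⟩-inj₁ eq')
              , λ x → (λ _ → ⟨ x , h ∘ x ⟩ , x ,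
                         (⟨⟩∘ ⨾ ⟨⟩-cong identityˡ (⟨⟩∘ ⨾ ⟨⟩-cong identityˡ ≈refl)))
                    , λ _ → !-unique )
        in w , λ x →
          let z , eq = sub x _ (member w x)
              eq' = ≈sym ⟨⟩∘ ⨾ eq
          in assoc ⨾ refl⟩∘⟨ (≈sym (⟨⟩-inj₂ eq')) ⨾ pullˡ project₂
             ⨾ refl⟩∘⟨ (≈sym identityˡ ⨾ ⟨⟩-inj₁ eq')
    }
    where
    open FullFamily (closed (π₁ {X} {Y}) (! {X}))

    selection : Σ (F ×ₒ X ⇒ X ×ₒ Y) λ s → ∀ p → ⟪ π₁ ∘ p , π₂ ∘ p , s ∘ p ⟫ ∈[ α ]
    selection = choose (mem α ⟪ π₁ · ↑ here , ⟪ π₂ · ↑ here , v₀ ⟫ₜ ⟫ₜ)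
      λ p → proj₁ (proj₂ isFamily _ _) !-unique

    chosenPoint = proj₁ selection

    member : ∀ w x → ⟪ w , x , chosenPoint ∘ ⟨ w , x ⟩ ⟫ ∈[ α ]
    member w x = ∈-resp (⟨⟩-cong project₁ (⟨⟩-cong project₂ ≈refl)) (proj₂ selection ⟨ w , x ⟩)

-- Standard natural numbers, induction, and finite chains.

module Naturals {o ℓ e} (C : Category o ℓ e)
    (fp : Notions.FiniteProducts C)
    (we : Notions.WeakEqualisers C)
    (fs : Notions.FiniteSums C)
    (choice : ∀ (X : Category.Obj C) →
      Elements.ChoiceObject C (Notions.FiniteProducts.terminal fp)
        (Notions.FiniteProducts.product fp) X)
    (indec : Elements.IndecomposableTerminal C (Notions.FiniteProducts.terminal fp)
      (Notions.FiniteProducts.product fp))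
    (closed : Elements.ClosedForPseudoRelations C (Notions.FiniteProducts.terminal fp)
      (Notions.FiniteProducts.product fp))
    (wnno : Elements.WeakNNO C (Notions.FiniteProducts.terminal fp)
      (Notions.FiniteProducts.product fp))
    where
  open Logic C fp we fs choice indec closed public
  open WeakNNO wnno public
  open Rep
  open WeakExponential

  private variable
    a b : Level

  private
    NN : WeakExponential N N
    NN = weakExponential N N

  -- A weakly initial algebra becomes initial on the joint equaliser of its
  -- endomorphisms.
  Standard : Elem N → Set (ℓ ⊔ e)
  Standard n = ∀ (w : Elem (Fun NN)) →
    (ev NN ∘ ⟨ w , zero ⟩ ≈ zero) × (∀ k → ev NN ∘ ⟨ w , succ ∘ k ⟩ ≈ succ ∘ (ev NN ∘ ⟨ w , k ⟩)) →
    ev NN ∘ ⟨ w , n ⟩ ≈ n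

  standard-rep : Rep ⌈ N ⌉ Standard
  standard-rep = ∀̇ (Fun NN)
    ( (ev NN · ⟪ v₀ , const zero ⟫ₜ ≐ const zero) ∧
      ∀̇ N (ev NN · ⟪ ↑ v₀ , succ · v₀ ⟫ₜ ≐ succ · (ev NN · ⟪ ↑ v₀ , v₀ ⟫ₜ))
    ⊃ (ev NN · ⟪ v₀ , ↑ here ⟫ₜ ≐ ↑ here))

  standard-zero : Standard zero
  standard-zero w (z , _) = z

  standard-succ : ∀ {n} → Standard n → Standard (succ ∘ n)
  standard-succ std w h = proj₂ h _ ⨾ refl⟩∘⟨ std w h

  abstract
    -- Base and step lift to an algebra structure `z`, `s` on `Ext rep`. Weak recursion into it,
    -- followed by `ext rep`, is an algebra endomorphism of `N`; it fixes a standard `n`, which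
    -- therefore lies in the image. The step is asked of all `n`; where it is known for standard
    -- ones only, `Standard` is conjoined to the predicate.
    induction : (P : Elem N → Set a) → Rep ⌈ N ⌉ P → P zero → (∀ n → P n → P (succ ∘ n)) →
                ∀ n → Standard n → P n
    induction P rep base step n std =
      let z , z-eq = to rep zero base
          s , s-eq = factor (ext rep) (succ ∘ ext rep) λ w →
            ∈-resp (≈sym assoc) (to rep _ (step _ (from rep _ (w , ≈refl))))
          g , g-zero , g-succ = rec z s
          w , w-eq = name NN (ext rep ∘ g)
          h = ext rep ∘ g
          fixed = std w
            ( (w-eq zero ⨾ pullʳ g-zero ⨾ z-eq)
            , λ k → w-eq _ ⨾ pullˡ (pullʳ g-succ ⨾ pullˡ s-eq ⨾ assoc) ⨾ assoc
                    ⨾ refl⟩∘⟨ ≈sym (w-eq k) )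
      in from rep n (g ∘ n , ≈sym assoc ⨾ ≈sym (w-eq n) ⨾ fixed)

  -- Only the standard links of a chain count. Prepending a link and induction
  -- along a chain suffice for symmetry and transitivity, so chains are never
  -- concatenated.
  module Chains {Z : Obj} (G : Elem Z → Elem Z → Set a)
      (G-rep : Rep (⌈ Z ⌉ ▹ Z) (λ (y , z) → G y z))
      (G-refl : ∀ {z} → G z z) (G-sym : ∀ {y z} → G y z → G z y) where

    private
      NZ : WeakExponential N Z
      NZ = weakExponential N Z

      _at_ : Elem (Fun NZ) → Elem N → Elem Z
      w at k = ev NZ ∘ ⟨ w , k ⟩

      atₜ : ∀ {Γ} {w : Env Γ → Elem (Fun NZ)} {k : Env Γ → Elem N} →
            Term Γ w → Term Γ k → Term Γ (λ γ → w γ at k γ)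
      atₜ w k = ev NZ · ⟪ w , k ⟫ₜ

      G-resp : ∀ {y y' z z'} → y ≈ y' → z ≈ z' → G y z → G y' z'
      G-resp p q = resp G-rep {γ = _ , _} {δ = _ , _} (⟨⟩-cong p q)

    -- Links are demanded at every standard `k` and not only below `n`, so no order on `N` is
    -- needed; reflexivity of `G` provides them for the constant chain.
    Chain : Elem Z → Elem Z → Set (ℓ ⊔ e ⊔ a)
    Chain y z = Σ (Elem (Fun NZ)) λ w → Σ (Elem N) λ n → Standard n ×
      (w at zero ≈ y) × (w at n ≈ z) × (∀ k → Standard k → G (w at k) (w at (succ ∘ k)))

    abstract
      chain-rep : Rep (⌈ Z ⌉ ▹ Z) (λ (y , z) → Chain y z)
      chain-rep = ∃̇ (Fun NZ) (∃̇ N (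
        standard-rep ⟨ v₀ ⟩₁ ∧
        (atₜ (↑ v₀) (const zero) ≐ ↑ (↑ (↑ here))) ∧
        (atₜ (↑ v₀) v₀ ≐ ↑ (↑ v₀)) ∧
        ∀̇ N (standard-rep ⟨ v₀ ⟩₁ ⊃ G-rep ⟨ atₜ (↑ (↑ v₀)) v₀ , atₜ (↑ (↑ v₀)) (succ · v₀) ⟩₂)))

    chain-refl : ∀ z → Chain z z
    chain-refl z =
      let w , w-eq = name NZ (z ∘ !)
          constant : ∀ k → w at k ≈ z
          constant k = w-eq k ⨾ const∘
      in w , zero , standard-zero , constant zero , constant zero ,
         λ k _ → G-resp (≈sym (constant k)) (≈sym (constant _)) G-refl

    chain-cons : ∀ {x y z} → G x y → Chain y z → Chain x z
    chain-cons {x} Gxy (w , n , std-n , w-zero , w-n , links) =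
      -- Recursion only iterates an arrow, so the stage is carried along: the state at `k` is `k`
      -- with the `k`-th entry of the new chain, and its successor reads off `w` at `k`. The counter
      -- is correct at standard stages.
      let g , g-zero , g-succ = rec ⟨ zero , x ⟩ ⟨ succ ∘ π₁ , ev NZ ∘ ⟨ w ∘ ! , π₁ ⟩ ⟩
          counts : ∀ k → Standard k → π₁ ∘ (g ∘ k) ≈ k
          counts = induction (λ k → π₁ ∘ (g ∘ k) ≈ k) (π₁ · g · here ≐ here)
            (refl⟩∘⟨ g-zero ⨾ project₁)
            λ k eq → refl⟩∘⟨ (pullˡ g-succ ⨾ assoc) ⨾ pullˡ project₁ ⨾ pullʳ eq
          v , v-eq = name NZ (π₂ ∘ g)
          v-zero : v at zero ≈ x
          v-zero = v-eq zero ⨾ pullʳ g-zero ⨾ project₂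
          v-succ : ∀ k → Standard k → v at (succ ∘ k) ≈ w at k
          v-succ k std = v-eq _ ⨾ pullʳ (pullˡ g-succ ⨾ assoc) ⨾ pullˡ project₂
            ⨾ pullʳ (⟨⟩∘ ⨾ ⟨⟩-cong const∘ (counts k std))
          -- Induction acts as a case distinction between zero and a successor: of the hypothesis
          -- only standardness is taken.
          linked : ∀ k → Standard k → Standard k × G (v at k) (v at (succ ∘ k))
          linked = induction _
            (standard-rep ∧ G-rep ⟨ atₜ (const v) here , atₜ (const v) (succ · here) ⟩₂)
            ( standard-zero
            , G-resp (≈sym v-zero) (≈sym (v-succ zero standard-zero ⨾ w-zero)) Gxy )
            λ { k (std , _) → standard-succ std ,
                G-resp (≈sym (v-succ k std)) (≈sym (v-succ _ (standard-succ std))) (links k std) }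
      in v , succ ∘ n , standard-succ std-n , v-zero , (v-succ n std-n ⨾ w-n) ,
         λ k std → proj₂ (linked k std)

    G⇒chain : ∀ {y z} → G y z → Chain y z
    G⇒chain Gyz = chain-cons Gyz (chain-refl _)

    -- Induction on the position along the chain. This is the minimality of `Chain` among
    -- representable relations, and the universal property of the quotient rests on it.
    chain-fold : ∀ {s} (S : Elem Z → Set s) → Rep ⌈ Z ⌉ S → (∀ {y z} → G y z → S y → S z) →
                 ∀ {y z} → Chain y z → S y → S z
    chain-fold S S-rep closedS (w , n , std-n , w-zero , w-n , links) Sy =
      resp S-rep w-n (proj₂ (induction _ (standard-rep ∧ S-rep ⟨ atₜ (const w) here ⟩₁)
        (standard-zero , resp S-rep (≈sym w-zero) Sy)
        (λ { k (std , Sk) → standard-succ std , closedS (links k std) Sk })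
        n std-n))

    chain-sym : ∀ {y z} → Chain y z → Chain z y
    chain-sym {y} c =
      chain-fold (λ z → Chain z y) (chain-rep ⟨ here , const y ⟩₂)
        (λ Guv → chain-cons (G-sym Guv)) c (chain-refl y)

    -- Appending a link amounts to prepending it to the reversed chain.
    chain-trans : ∀ {x y z} → Chain x y → Chain y z → Chain x z
    chain-trans {x} c d = chain-fold (Chain x) (chain-rep ⟨ const x , here ⟩₂)
      (λ Guv c → chain-sym (chain-cons (G-sym Guv) (chain-sym c))) d c

-- The exact completion described by elements.

module Completion {o ℓ e} (C : Category o ℓ e)
    (fp : Notions.FiniteProducts C)
    (we : Notions.WeakEqualisers C)
    (fs : Notions.FiniteSums C)
    (choice : ∀ (X : Category.Obj C) →
      Elements.ChoiceObject C (Notions.FiniteProducts.terminal fp)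
        (Notions.FiniteProducts.product fp) X)
    (nondeg : Elements.NonDegenerate C (Notions.FiniteProducts.terminal fp)
      (Notions.FiniteProducts.product fp) (Notions.FiniteSums.initial fs))
    (indec : Elements.IndecomposableTerminal C (Notions.FiniteProducts.terminal fp)
      (Notions.FiniteProducts.product fp))
    (lext : Lextensive.WeaklyLextensive C fp fs)
    (closed : Elements.ClosedForPseudoRelations C (Notions.FiniteProducts.terminal fp)
      (Notions.FiniteProducts.product fp))
    (wnno : Elements.WeakNNO C (Notions.FiniteProducts.terminal fp)
      (Notions.FiniteProducts.product fp))
    where
  open Naturals C fp we fs choice indec closed wnno public
  open ExactCompletion C fp we public using (PER; PERHom; perHom; Cex; _∼_; ∼-sym; ∼-trans; idH; _∘H_)
  open PER public using () renaming (X to ∣_∣; r to rel)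
  open PERHom public using () renaming (f to fun)
  open Rep
  module 𝓔 = Notions Cex

  private variable
    a b : Level
    A B D : PER
    W : Obj
    Γ : Ctx

  Eq : (A : PER) → Elem ∣ A ∣ → Elem ∣ A ∣ → Set (ℓ ⊔ e)
  Eq A x y = ⟨ x , y ⟩ ∈[ rel A ]

  abstract
    Eq-refl : (A : PER) → ∀ {x y} → x ≈ y → Eq A x y
    Eq-refl A {x} eq = PER.ρ A ∘ x ,
      (pullˡ (PER.ρ-eq A) ⨾ ⟨⟩∘ ⨾ ⟨⟩-cong identityˡ (identityˡ ⨾ eq))

    Eq-sym : (A : PER) → ∀ {x y} → Eq A x y → Eq A y x
    Eq-sym A (h , eq) = PER.σ A ∘ h ,
      (pullˡ (PER.σ-eq A) ⨾ ⟨⟩∘ ⨾ ⟨⟩-cong (proj-eq₂ eq) (proj-eq₁ eq))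

    Eq-trans : (A : PER) → ∀ {x y z} → Eq A x y → Eq A y z → Eq A x z
    Eq-trans A (h , p) (k , q) =
      let W , p₁ , p₂ , isWP = weakPullback (π₂ ∘ rel A) (π₁ ∘ rel A)
          l , l₁ , l₂ = proj₂ isWP h k (proj-eq₂ p ⨾ ≈sym (proj-eq₁ q))
          t , t-eq = PER.τ A p₁ p₂ isWP
      in t ∘ l , (pullˡ t-eq ⨾ ⟨⟩∘ ⨾ ⟨⟩-cong (pullʳ l₁ ⨾ proj-eq₁ p) (pullʳ l₂ ⨾ proj-eq₂ q))

  Eqₜ : (A : PER) → ∀ {t u : Env Γ → Elem ∣ A ∣} → Term Γ t → Term Γ u →
        Rep Γ (λ γ → Eq A (t γ) (u γ))
  Eqₜ A t u = mem (rel A) ⟪ t , u ⟫ₜ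

  module _ {X : Obj} {E : Elem X → Elem X → Set a}
      (rep : Rep (⌈ X ⌉ ▹ X) (λ (x , y) → E x y)) (equivalence : IsEquivalence E) where
    private
      module E = IsEquivalence equivalence
      s = π₁ ∘ ext rep
      t = π₂ ∘ ext rep

    abstract
      related : ∀ (w : Elem (Ext rep)) → E (s ∘ w) (t ∘ w)
      related w = from rep _ (w , η ⨾ ⟨⟩-cong (≈sym assoc) (≈sym assoc))

      reflexivity : Σ (X ⇒ Ext rep) λ ρ → ext rep ∘ ρ ≈ ⟨ id , id ⟩
      reflexivity = factor (ext rep) ⟨ id , id ⟩ λ x →
        ∈-resp (⟨⟩-cong (≈sym identityˡ) (≈sym identityˡ) ⨾ ≈sym ⟨⟩∘) (to rep (x , x) E.refl)

      symmetry : Σ (Ext rep ⇒ Ext rep) λ σ → ext rep ∘ σ ≈ ⟨ t , s ⟩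
      symmetry = factor (ext rep) ⟨ t , s ⟩ λ w →
        ∈-resp (≈sym ⟨⟩∘) (to rep (_ , _) (E.sym (related w)))

      transitivity : ∀ {Q} (p₁ p₂ : Q ⇒ Ext rep) → IsWeakPullback p₁ p₂ t s →
                     Σ (Q ⇒ Ext rep) λ τ → ext rep ∘ τ ≈ ⟨ s ∘ p₁ , t ∘ p₂ ⟩
      transitivity p₁ p₂ (commutes , _) = factor (ext rep) _ λ q →
        let composable = E.trans (related (p₁ ∘ q))
              (resp rep {_ , _} {_ , _} (⟨⟩-cong (≈sym (≈sym assoc ⨾ commutes ⟩∘⟨refl ⨾ assoc)) ≈refl)
                (related (p₂ ∘ q)))
        in ∈-resp (⟨⟩-cong (≈sym assoc) (≈sym assoc) ⨾ ≈sym ⟨⟩∘) (to rep (_ , _) composable)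

    -- Objects of the completion may be given by laws on elements: `factor` turns the three laws of
    -- an equivalence into the structure arrows.
    quotient : PER
    quotient = record
      { X = X ; R = Ext rep ; r = ext rep
      ; ρ = proj₁ reflexivity ; ρ-eq = proj₂ reflexivity
      ; σ = proj₁ symmetry ; σ-eq = proj₂ symmetry
      ; τ = transitivity
      }

  abstract
    tracking : (h : ∣ A ∣ ⇒ ∣ B ∣) → (∀ x y → Eq A x y → Eq B (h ∘ x) (h ∘ y)) →
               Σ (PER.R A ⇒ PER.R B) λ ĥ → rel B ∘ ĥ ≈ (h ⊗ h) ∘ rel A
    tracking {A} {B} h preserves = factor (rel B) ((h ⊗ h) ∘ rel A) λ w →
      ∈-resp (≈sym ⊗-⟨⟩ ⨾ refl⟩∘⟨ ≈sym η ⨾ ≈sym assoc) (preserves _ _ (w , η))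

  arrow : (h : ∣ A ∣ ⇒ ∣ B ∣) → (∀ x y → Eq A x y → Eq B (h ∘ x) (h ∘ y)) → PERHom A B
  arrow {A} {B} h preserves =
    perHom h (proj₁ (tracking {A} {B} h preserves)) (proj₂ (tracking {A} {B} h preserves))

  abstract
    preserve : (u : PERHom A B) → ∀ {x y} → Eq A x y → Eq B (fun u ∘ x) (fun u ∘ y)
    preserve u (w , eq) = PERHom.f̂ u ∘ w , (pullˡ (PERHom.comm u) ⨾ pullʳ eq ⨾ ⊗-⟨⟩)

    -- A homotopy from `u` to `v` is a factorisation of the pair of underlying arrows through
    -- `rel B`, which `factor` finds from elements.
    pointwise : (u v : PERHom A B) → (∀ x → Eq B (fun u ∘ x) (fun v ∘ x)) → u ∼ v
    pointwise {B = B} u v eq = factor (rel B) ⟨ fun u , fun v ⟩ λ x → ∈-resp (≈sym ⟨⟩∘) (eq x)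

    at : (u v : PERHom A B) → u ∼ v → ∀ x → Eq B (fun u ∘ x) (fun v ∘ x)
    at u v (h , eq) x = h ∘ x , (pullˡ eq ⨾ ⟨⟩∘)

    ≈-rep : ∀ X → Rep (⌈ X ⌉ ▹ X) (λ (x , y) → x ≈ y)
    ≈-rep X = ↑ here ≐ v₀

    restrict-rep : (A : PER) (i : W ⇒ ∣ A ∣) →
                   Rep (⌈ W ⌉ ▹ W) (λ (x , y) → Eq A (i ∘ x) (i ∘ y))
    restrict-rep A i = Eqₜ A (i · ↑ here) (i · v₀)

  -- The embedding of C into its completion, up to isomorphism.
  discrete : Obj → PER
  discrete X = quotient (≈-rep X) equiv

  discrete-≈ : ∀ X {x y : Elem X} → Eq (discrete X) x y → x ≈ y
  discrete-≈ X {x} {y} eq = from (≈-rep X) (x , y) eq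

  discrete-arrow : ∀ {X} → X ⇒ ∣ B ∣ → PERHom (discrete X) B
  discrete-arrow {B} {X} h = arrow {discrete X} {B} h λ x y eq →
    Eq-refl B (refl⟩∘⟨ discrete-≈ X eq)

  -- The subobject cut out by i, or equally the image of any arrow given by i.
  restrict : (A : PER) → W ⇒ ∣ A ∣ → PER
  restrict A i = quotient (restrict-rep A i)
    record { refl = Eq-refl A ≈refl ; sym = Eq-sym A ; trans = Eq-trans A }

  module Restrict (A : PER) {W} (i : W ⇒ ∣ A ∣) where
    include : PERHom (restrict A i) A
    include = arrow {restrict A i} i λ x y eq → from (restrict-rep A i) (x , y) eq

    include-reflects : ∀ {x y} → Eq A (i ∘ x) (i ∘ y) → Eq (restrict A i) x y
    include-reflects {x} {y} eq = to (restrict-rep A i) (x , y) eq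

    include-mono : 𝓔.Mono include
    include-mono u v eq = pointwise u v λ x →
      include-reflects (Eq-trans A (Eq-refl A (≈sym assoc))
        (Eq-trans A (at (include ∘H u) (include ∘H v) eq x) (Eq-refl A assoc)))

    -- The preimages `w` are chosen independently of each other; they respect equality because
    -- equality in the restriction is that of `A` after `i`.
    corestrict : (u : PERHom D A) → (∀ x → Σ (Elem W) λ w → Eq A (i ∘ w) (fun u ∘ x)) →
                 Σ (PERHom D (restrict A i)) λ k → ∀ x → Eq A (i ∘ (fun k ∘ x)) (fun u ∘ x)
    corestrict {D} u total =
      let k , k-eq = choose (Eqₜ A (i · v₀) (fun u · ↑ here)) total
      in arrow {D} {restrict A i} k (λ x y eq → include-reflects
           (Eq-trans A (k-eq x) (Eq-trans A (preserve u eq) (Eq-sym A (k-eq y)))))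
         , k-eq

  -- Finite limits of the completion.

  terminalₑ : 𝓔.Terminal
  terminalₑ = record
    { ⊤ = discrete 𝟙
    ; isTerminal = λ A →
        let u = arrow {A} {discrete 𝟙} ! λ x y _ → Eq-refl (discrete 𝟙) !-unique
        in u , λ v → pointwise v u λ x → Eq-refl (discrete 𝟙) !-unique
    }

  module Productₑ (A B : PER) where
    abstract
      Eq×-rep : Rep (⌈ ∣ A ∣ ×ₒ ∣ B ∣ ⌉ ▹ (∣ A ∣ ×ₒ ∣ B ∣))
                (λ (p , q) → Eq A (π₁ ∘ p) (π₁ ∘ q) × Eq B (π₂ ∘ p) (π₂ ∘ q))
      Eq×-rep = Eqₜ A (π₁ · ↑ here) (π₁ · v₀) ∧ Eqₜ B (π₂ · ↑ here) (π₂ · v₀)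

    A×B : PER
    A×B = quotient Eq×-rep record
      { refl = Eq-refl A ≈refl , Eq-refl B ≈refl
      ; sym = λ (p , q) → Eq-sym A p , Eq-sym B q
      ; trans = λ (p , q) (p' , q') → Eq-trans A p p' , Eq-trans B q q'
      }

    fst : PERHom A×B A
    fst = arrow {A×B} π₁ λ x y eq → proj₁ (from Eq×-rep (x , y) eq)

    snd : PERHom A×B B
    snd = arrow {A×B} π₂ λ x y eq → proj₂ (from Eq×-rep (x , y) eq)

    Eq-pair : ∀ {x x' y y'} → Eq A x x' → Eq B y y' → Eq A×B ⟨ x , y ⟩ ⟨ x' , y' ⟩
    Eq-pair p q = to Eq×-rep (_ , _)
      ( Eq-trans A (Eq-refl A project₁) (Eq-trans A p (Eq-refl A (≈sym project₁)))
      , Eq-trans B (Eq-refl B project₂) (Eq-trans B q (Eq-refl B (≈sym project₂))) )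

    pair : PERHom D A → PERHom D B → PERHom D A×B
    pair {D} u v = arrow {D} {A×B} ⟨ fun u , fun v ⟩ λ x y eq →
      Eq-trans A×B (Eq-refl A×B ⟨⟩∘)
        (Eq-trans A×B (Eq-pair (preserve u eq) (preserve v eq)) (Eq-refl A×B (≈sym ⟨⟩∘)))

    productₑ : 𝓔.Product A B
    productₑ = record
      { obj = A×B ; π₁ = fst ; π₂ = snd
      ; isProduct = λ {D} u v → pair u v
          , pointwise (fst ∘H pair u v) u (λ x → Eq-refl A (project₁ ⟩∘⟨refl))
          , pointwise (snd ∘H pair u v) v (λ x → Eq-refl B (project₂ ⟩∘⟨refl))
          , λ w p q → pointwise w (pair u v) λ x →
              Eq-trans A×B (Eq-refl A×B (η ⨾ ⟨⟩-cong (≈sym assoc) (≈sym assoc)))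
                (Eq-trans A×B (Eq-pair (at (fst ∘H w) u p x) (at (snd ∘H w) v q x))
                  (Eq-refl A×B (≈sym ⟨⟩∘)))
      }

  module Equaliserₑ {A B : PER} (u v : PERHom A B) where
    private rep = Eqₜ B (fun u · here) (fun v · here)
    open Restrict A (ext rep)

    equaliserₑ : 𝓔.Equaliser u v
    equaliserₑ = record
      { obj = restrict A (ext rep) ; arr = include
      ; isEqualiser =
          pointwise (u ∘H include) (v ∘H include)
            (λ w → Eq-trans B (Eq-refl B assoc)
              (Eq-trans B (from rep (ext rep ∘ w) (w , ≈refl)) (Eq-refl B (≈sym assoc))))
          , λ {D} h eq →
              let k , k-eq = corestrict {D} h λ x →
                    let w , w-eq = to rep (fun h ∘ x) (Eq-trans B (Eq-refl B (≈sym assoc))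
                          (Eq-trans B (at (u ∘H h) (v ∘H h) eq x) (Eq-refl B assoc)))
                    in w , Eq-refl A w-eq
                  factors = pointwise (include ∘H k) h
                    λ x → Eq-trans A (Eq-refl A assoc) (k-eq x)
              in k , factors , λ k' eq' → include-mono k' k
                   (Category.≈trans Cex {f = include ∘H k'} {g = h} {h = include ∘H k} eq'
                     (Category.≈sym Cex {f = include ∘H k} {g = h} factors))
      }

  finiteLimits : 𝓔.FiniteLimits
  finiteLimits = record
    { terminal = terminalₑ ; product = Productₑ.productₑ ; equaliser = Equaliserₑ.equaliserₑ }

  -- Finite colimits of the completion.

  initial-empty : ¬ Elem (Initial.⊥ (FiniteSums.initial fs))
  initial-empty x =
    nondeg (x , Initial.¡ (FiniteSums.initial fs) , !-unique ,
      (proj₂ (Initial.isInitial (FiniteSums.initial fs) _) _ ⨾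
       ≈sym (proj₂ (Initial.isInitial (FiniteSums.initial fs) _) _)))

  initialₑ : 𝓔.Initial
  initialₑ = record
    { ⊥ = 𝟘
    ; isInitial = λ A →
        let u = arrow {𝟘} {A} (Initial.¡ (FiniteSums.initial fs)) λ x → ⊥-elim (initial-empty x)
        in u , λ v → pointwise v u λ x → ⊥-elim (initial-empty x)
    }
    where 𝟘 = discrete (Initial.⊥ (FiniteSums.initial fs))

  -- `i₁` has the retraction `[ id , x ∘ ! ]`, with `x` itself as default value on the other
  -- summand.
  i₁-injective : ∀ {A B} {x y : Elem A} → i₁ {A} {B} ∘ x ≈ i₁ ∘ y → x ≈ y
  i₁-injective {x = x} eq = ≈sym (pullˡ [,]-i₁ ⨾ identityˡ)
    ⨾ ∘-resp-≈ (≈refl {f = [ id , x ∘ ! ]}) eq ⨾ pullˡ [,]-i₁ ⨾ identityˡ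

  i₂-injective : ∀ {A B} {x y : Elem B} → i₂ {A} {B} ∘ x ≈ i₂ ∘ y → x ≈ y
  i₂-injective {x = x} eq = ≈sym (pullˡ [,]-i₂ ⨾ identityˡ)
    ⨾ ∘-resp-≈ (≈refl {f = [ x ∘ ! , id ]}) eq ⨾ pullˡ [,]-i₂ ⨾ identityˡ

  -- Disjointness would make such a coincidence an element of the initial object.
  i₁≉i₂ : ∀ {A B} {x : Elem A} {y : Elem B} → ¬ (i₁ {A} {B} ∘ x ≈ i₂ ∘ y)
  i₁≉i₂ eq = initial-empty (proj₁ (proj₂ (Lextensive.WeaklyLextensive.disjoint lext _ _) _ _ eq))

  module Coproductₑ (A B : PER) where
    -- Stated by existence of preimages rather than by cases on the summand, so that it is a formula
    -- built from `∃̇`, `∧` and `∨`.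
    Eq₊ : Elem (∣ A ∣ +ₒ ∣ B ∣) → Elem (∣ A ∣ +ₒ ∣ B ∣) → Set (ℓ ⊔ e)
    Eq₊ s t = (Σ (Elem ∣ A ∣) λ x → Σ (Elem ∣ A ∣) λ y → (s ≈ i₁ ∘ x) × (t ≈ i₁ ∘ y) × Eq A x y)
            ⊎ (Σ (Elem ∣ B ∣) λ x → Σ (Elem ∣ B ∣) λ y → (s ≈ i₂ ∘ x) × (t ≈ i₂ ∘ y) × Eq B x y)

    abstract
      Eq₊-rep : Rep (⌈ ∣ A ∣ +ₒ ∣ B ∣ ⌉ ▹ (∣ A ∣ +ₒ ∣ B ∣)) (λ (s , t) → Eq₊ s t)
      Eq₊-rep =
          ∃̇ _ (∃̇ _ ((↑ (↑ (↑ here)) ≐ i₁ · ↑ v₀) ∧ (↑ (↑ v₀) ≐ i₁ · v₀) ∧ Eqₜ A (↑ v₀) v₀))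
        ∨ ∃̇ _ (∃̇ _ ((↑ (↑ (↑ here)) ≐ i₂ · ↑ v₀) ∧ (↑ (↑ v₀) ≐ i₂ · v₀) ∧ Eqₜ B (↑ v₀) v₀))

    Eq₊-refl : ∀ {s} → Eq₊ s s
    Eq₊-refl {s} with +-elem s
    ... | inj₁ (x , eq) = inj₁ (x , x , ≈sym eq , ≈sym eq , Eq-refl A ≈refl)
    ... | inj₂ (x , eq) = inj₂ (x , x , ≈sym eq , ≈sym eq , Eq-refl B ≈refl)

    Eq₊-sym : ∀ {s t} → Eq₊ s t → Eq₊ t s
    Eq₊-sym (inj₁ (x , y , p , q , eq)) = inj₁ (y , x , q , p , Eq-sym A eq)
    Eq₊-sym (inj₂ (x , y , p , q , eq)) = inj₂ (y , x , q , p , Eq-sym B eq)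

    Eq₊-trans : ∀ {s t u} → Eq₊ s t → Eq₊ t u → Eq₊ s u
    Eq₊-trans (inj₁ (x , y , p , q , eq)) (inj₁ (x' , y' , p' , q' , eq')) =
      inj₁ (x , y' , p , q' , Eq-trans A eq
        (Eq-trans A (Eq-refl A (i₁-injective (≈sym q ⨾ p'))) eq'))
    Eq₊-trans (inj₂ (x , y , p , q , eq)) (inj₂ (x' , y' , p' , q' , eq')) =
      inj₂ (x , y' , p , q' , Eq-trans B eq
        (Eq-trans B (Eq-refl B (i₂-injective (≈sym q ⨾ p'))) eq'))
    Eq₊-trans (inj₁ (_ , _ , _ , q , _)) (inj₂ (_ , _ , p , _)) = ⊥-elim (i₁≉i₂ (≈sym q ⨾ p))
    Eq₊-trans (inj₂ (_ , _ , _ , q , _)) (inj₁ (_ , _ , p , _)) = ⊥-elim (i₁≉i₂ (≈sym p ⨾ q))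

    A+B : PER
    A+B = quotient Eq₊-rep
      record { refl = Eq₊-refl ; sym = Eq₊-sym ; trans = Eq₊-trans }

    inl : PERHom A A+B
    inl = arrow {A} {A+B} i₁ λ x y eq → to Eq₊-rep (_ , _) (inj₁ (x , y , ≈refl , ≈refl , eq))

    inr : PERHom B A+B
    inr = arrow {B} {A+B} i₂ λ x y eq → to Eq₊-rep (_ , _) (inj₂ (x , y , ≈refl , ≈refl , eq))

    module _ {D : PER} (u : PERHom A D) (v : PERHom B D) where
      private
        h : ∣ A ∣ +ₒ ∣ B ∣ ⇒ ∣ D ∣
        h = [ fun u , fun v ]

        h-i₁ : ∀ {s} {x : Elem ∣ A ∣} → s ≈ i₁ ∘ x → h ∘ s ≈ fun u ∘ x
        h-i₁ p = refl⟩∘⟨ p ⨾ pullˡ [,]-i₁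

        h-i₂ : ∀ {s} {x : Elem ∣ B ∣} → s ≈ i₂ ∘ x → h ∘ s ≈ fun v ∘ x
        h-i₂ p = refl⟩∘⟨ p ⨾ pullˡ [,]-i₂

        preserves : ∀ {s t} → Eq₊ s t → Eq D (h ∘ s) (h ∘ t)
        preserves (inj₁ (x , y , p , q , eq)) = Eq-trans D (Eq-refl D (h-i₁ p))
          (Eq-trans D (preserve u eq) (Eq-refl D (≈sym (h-i₁ q))))
        preserves (inj₂ (x , y , p , q , eq)) = Eq-trans D (Eq-refl D (h-i₂ p))
          (Eq-trans D (preserve v eq) (Eq-refl D (≈sym (h-i₂ q))))

      copair : PERHom A+B D
      copair = arrow {A+B} h λ s t eq → preserves (from Eq₊-rep (s , t) eq)

      copair-unique : (w : PERHom A+B D) → (w ∘H inl) ∼ u → (w ∘H inr) ∼ v → w ∼ copair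
      copair-unique w p q = pointwise w copair λ s → agree s (+-elem s)
        where
        agree : ∀ s → (s ∈[ i₁ ]) ⊎ (s ∈[ i₂ ]) → Eq D (fun w ∘ s) (h ∘ s)
        agree s (inj₁ (x , eq)) = Eq-trans D (Eq-refl D (refl⟩∘⟨ ≈sym eq ⨾ ≈sym assoc))
          (Eq-trans D (at (w ∘H inl) u p x) (Eq-refl D (≈sym (h-i₁ (≈sym eq)))))
        agree s (inj₂ (x , eq)) = Eq-trans D (Eq-refl D (refl⟩∘⟨ ≈sym eq ⨾ ≈sym assoc))
          (Eq-trans D (at (w ∘H inr) v q x) (Eq-refl D (≈sym (h-i₂ (≈sym eq)))))

    coproductₑ : 𝓔.Coproduct A B
    coproductₑ = record
      { obj = A+B ; i₁ = inl ; i₂ = inr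
      ; isCoproduct = λ {D} u v → copair u v
          , pointwise (copair u v ∘H inl) u (λ x → Eq-refl D ([,]-i₁ ⟩∘⟨refl))
          , pointwise (copair u v ∘H inr) v (λ x → Eq-refl D ([,]-i₂ ⟩∘⟨refl))
          , copair-unique u v
      }

  module Coequaliserₑ {A B : PER} (u v : PERHom A B) where
    -- Symmetrised in advance, since `Chains` expects a reflexive symmetric relation; equality in
    -- `B` counts as a link so that the quotient arrow preserves it.
    Link : Elem ∣ B ∣ → Elem ∣ B ∣ → Set (ℓ ⊔ e)
    Link y z = Eq B y z ⊎
      ( (Σ (Elem ∣ A ∣) λ x → Eq B y (fun u ∘ x) × Eq B z (fun v ∘ x))
      ⊎ (Σ (Elem ∣ A ∣) λ x → Eq B y (fun v ∘ x) × Eq B z (fun u ∘ x)))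

    abstract
      link-rep : Rep (⌈ ∣ B ∣ ⌉ ▹ ∣ B ∣) (λ (y , z) → Link y z)
      link-rep = Eqₜ B (↑ here) v₀ ∨
        ( ∃̇ _ (Eqₜ B (↑ (↑ here)) (fun u · v₀) ∧ Eqₜ B (↑ v₀) (fun v · v₀))
        ∨ ∃̇ _ (Eqₜ B (↑ (↑ here)) (fun v · v₀) ∧ Eqₜ B (↑ v₀) (fun u · v₀)))

    link-sym : ∀ {y z} → Link y z → Link z y
    link-sym (inj₁ eq) = inj₁ (Eq-sym B eq)
    link-sym (inj₂ (inj₁ (x , p , q))) = inj₂ (inj₂ (x , q , p))
    link-sym (inj₂ (inj₂ (x , p , q))) = inj₂ (inj₁ (x , q , p))

    open Chains Link link-rep (inj₁ (Eq-refl B ≈refl)) link-sym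

    Q : PER
    Q = quotient chain-rep
      record { refl = chain-refl _ ; sym = chain-sym ; trans = chain-trans }

    q : PERHom B Q
    q = arrow {B} {Q} id λ x y eq → to chain-rep (_ , _) (G⇒chain (inj₁
      (Eq-trans B (Eq-refl B identityˡ) (Eq-trans B eq (Eq-refl B (≈sym identityˡ))))))

    module _ {D : PER} (h : PERHom B D) (eq : (h ∘H u) ∼ (h ∘H v)) where
      private
        identified : ∀ {y z x} → Eq B y (fun u ∘ x) → Eq B z (fun v ∘ x) →
                     Eq D (fun h ∘ y) (fun h ∘ z)
        identified {x = x} p q = Eq-trans D (preserve h p) (Eq-trans D (Eq-refl D (≈sym assoc))
          (Eq-trans D (at (h ∘H u) (h ∘H v) eq x)
            (Eq-trans D (Eq-refl D assoc) (Eq-sym D (preserve h q)))))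

        preserves : ∀ {y z} → Link y z → Eq D (fun h ∘ y) (fun h ∘ z)
        preserves (inj₁ p) = preserve h p
        preserves (inj₂ (inj₁ (x , p , q))) = identified p q
        preserves (inj₂ (inj₂ (x , p , q))) = Eq-sym D (identified q p)

      induced : PERHom Q D
      induced = arrow {Q} (fun h) λ x y c →
        chain-fold (λ z → Eq D (fun h ∘ x) (fun h ∘ z)) (Eqₜ D (const (fun h ∘ x)) (fun h · here))
          (λ l p → Eq-trans D p (preserves l)) (from chain-rep (x , y) c) (Eq-refl D ≈refl)

    coequaliserₑ : 𝓔.Coequaliser u v
    coequaliserₑ = record
      { obj = Q ; arr = q
      ; isCoequaliser =
          pointwise (q ∘H u) (q ∘H v) (λ x → to chain-rep (_ , _) (G⇒chain (inj₂ (inj₁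
            (x , Eq-refl B (identityˡ ⟩∘⟨refl) , Eq-refl B (identityˡ ⟩∘⟨refl))))))
          , λ {D} h eq → induced h eq
              , pointwise (induced h eq ∘H q) h (λ x → Eq-refl D (identityʳ ⟩∘⟨refl))
              , λ k' eq' → pointwise k' (induced h eq) λ x →
                  Eq-trans D (Eq-refl D (≈sym identityʳ ⟩∘⟨refl)) (at (k' ∘H q) h eq' x)
      }

  finiteColimits : 𝓔.FiniteColimits
  finiteColimits = record
    { initial = initialₑ ; coproduct = Coproductₑ.coproductₑ ; coequaliser = Coequaliserₑ.coequaliserₑ }

  -- Global elements and the natural numbers object of the completion.

  module 𝓔l = Elements Cex terminalₑ Productₑ.productₑ

  -- With `fun` as its inverse, this identifies the elements of `A` in the completion with those of
  -- its carrier. For such elements `u ∼ v` unfolds to `Eq A (fun u) (fun v)`, and the two are used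
  -- interchangeably.
  elt : Elem ∣ A ∣ → 𝓔l.Elem A
  elt {A} x = discrete-arrow {A} x

  mono-reflects : (m : PERHom A B) → 𝓔.Mono m →
                  ∀ x y → Eq B (fun m ∘ x) (fun m ∘ y) → Eq A x y
  mono-reflects {A} m mono x y eq = mono (elt {A} x) (elt {A} y) eq

  nno : 𝓔l.NNO
  nno = record
    { N = Nat
    ; zero = elt {Nat} (proj₁ zeroₙ)
    ; succ = succₙ
    ; rec = λ {A} x f → iterate {A} x f
        , Eq-trans A (Eq-refl A (pullʳ (proj₂ zeroₙ))) (Eq-refl A (proj₁ (proj₂ (rec (fun x) (fun f)))))
        , pointwise (iterate {A} x f ∘H succₙ) (f ∘H iterate {A} x f)
            (λ n → Eq-refl A (assoc ⨾ pullʳ (succₙ-eq n) ⨾ pullˡ (proj₂ (proj₂ (rec (fun x) (fun f)))) ⨾ pullʳ (≈sym assoc) ⨾ ≈sym assoc))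
        , iterate-unique {A} x f
    }
    where
    ε = ext standard-rep
    Nat = restrict (discrete N) ε
    open Restrict (discrete N) ε

    ε-reflects : ∀ {x y} → ε ∘ x ≈ ε ∘ y → Eq Nat x y
    ε-reflects eq = include-reflects (Eq-refl (discrete N) eq)

    standard-ε : ∀ n → Standard (ε ∘ n)
    standard-ε n = from standard-rep (ε ∘ n) (n , ≈refl)

    zeroₙ = to standard-rep zero standard-zero

    succε : PERHom Nat (discrete N)
    succε = arrow {Nat} {discrete N} (succ ∘ ε) λ x y eq →
      Eq-refl (discrete N) (pullʳ (discrete-≈ N (preserve include eq)) ⨾ ≈sym assoc)

    succ-spec = corestrict {Nat} succε λ n →
      let m , m-eq = to standard-rep (succ ∘ (ε ∘ n)) (standard-succ (standard-ε n))
      in m , Eq-refl (discrete N) (m-eq ⨾ ≈sym assoc)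

    succₙ : PERHom Nat Nat
    succₙ = proj₁ succ-spec

    succₙ-eq : ∀ n → ε ∘ (fun succₙ ∘ n) ≈ succ ∘ (ε ∘ n)
    succₙ-eq n = discrete-≈ N (proj₂ succ-spec n) ⨾ assoc

    module _ {A : PER} (x : 𝓔l.Elem A) (f : PERHom A A) where
      private
        h : N ⇒ ∣ A ∣
        h = proj₁ (rec (fun x) (fun f))

      iterate : PERHom Nat A
      iterate = arrow {Nat} {A} (h ∘ ε) λ m n eq →
        Eq-refl A (pullʳ (discrete-≈ N (preserve include eq)) ⨾ ≈sym assoc)

      iterate-unique : (g : PERHom Nat A) → (g ∘H elt {Nat} (proj₁ zeroₙ)) ∼ x →
                       (g ∘H succₙ) ∼ (f ∘H g) → g ∼ iterate
      iterate-unique g g-zero g-succ = pointwise g iterate λ n →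
        Eq-trans A (proj₂ (agree (ε ∘ n) (standard-ε n)) n ≈refl) (Eq-refl A (≈sym assoc))
        where
        -- `g` acts on `Ext standard-rep` and `ε` need not be monic in C, so the hypothesis speaks
        -- of every `n` that `ε` sends to `k`.
        agree : ∀ k → Standard k →
                Standard k × (∀ n → ε ∘ n ≈ k → Eq A (fun g ∘ n) (h ∘ k))
        agree = induction _
          (standard-rep ∧ ∀̇ (Ext standard-rep) ((ε · v₀ ≐ ↑ here) ⊃ Eqₜ A (fun g · v₀) (h · ↑ here)))
          ( standard-zero
          , λ n eq → Eq-trans A (preserve g (ε-reflects (eq ⨾ ≈sym (proj₂ zeroₙ))))
              (Eq-trans A g-zero (Eq-refl A (≈sym (proj₁ (proj₂ (rec (fun x) (fun f)))))) ) )
          λ { k (std , ih) → standard-succ std , λ n eq →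
                let m , m-eq = to standard-rep k std
                in Eq-trans A (preserve g (ε-reflects (eq ⨾ refl⟩∘⟨ ≈sym m-eq ⨾ ≈sym (succₙ-eq m))))
                     (Eq-trans A (Eq-refl A (≈sym assoc))
                     (Eq-trans A (at (g ∘H succₙ) (f ∘H g) g-succ m)
                     (Eq-trans A (Eq-refl A assoc)
                     (Eq-trans A (preserve f (ih m m-eq))
                       (Eq-refl A (≈sym (pullˡ (proj₂ (proj₂ (rec (fun x) (fun f)))) ⨾ assoc))))))) }

  -- Generator, choice covers, coproducts of the terminal object, and images.

  strong-generator : (u : PERHom A B) →
    (∀ (y : 𝓔l.Elem B) → Σ (𝓔l.Elem A) λ x → ((u ∘H x) ∼ y) ×
      (∀ (x' : 𝓔l.Elem A) → (u ∘H x') ∼ y → x' ∼ x)) →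
    𝓔.IsIso u
  strong-generator {A} {B} u bijective =
    v , pointwise (v ∘H u) (idH)
          (λ x → Eq-trans A (Eq-refl A assoc)
            (Eq-trans A (injective (v-eq (fun u ∘ x))) (Eq-refl A (≈sym identityˡ))))
      , pointwise (u ∘H v) (idH)
          (λ y → Eq-trans B (Eq-refl B assoc) (Eq-trans B (v-eq y) (Eq-refl B (≈sym identityˡ))))
    where
    injective : ∀ {x x'} → Eq B (fun u ∘ x) (fun u ∘ x') → Eq A x x'
    injective {x} {x'} eq =
      let _ , _ , only = bijective (elt {B} (fun u ∘ x'))
      in Eq-trans A (only (elt {A} x) eq) (Eq-sym A (only (elt {A} x') (Eq-refl B ≈refl)))

    chosen-inverse = choose (Eqₜ B (fun u · v₀) (↑ here)) λ y →
      let x , eq , _ = bijective (elt {B} y) in fun x , eq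

    v-eq : ∀ y → Eq B (fun u ∘ (proj₁ chosen-inverse ∘ y)) y
    v-eq = proj₂ chosen-inverse

    -- The inverse is a choice function, and injectivity of `u` makes it preserve equality.
    v : PERHom B A
    v = arrow {B} {A} (proj₁ chosen-inverse) λ y y' eq →
      injective (Eq-trans B (v-eq y) (Eq-trans B eq (Eq-sym B (v-eq y'))))

  -- A chosen section preserves equality automatically, because equality in its domain is that of C.
  discrete-choice : ∀ X → 𝓔l.ChoiceObject (discrete X)
  discrete-choice X {D} p surj =
    let s , s-eq = choose (Eqₜ (discrete X) (fun p · v₀) (↑ here)) λ y →
          let x , eq = surj (elt {discrete X} y) in fun x , eq
        σ = discrete-arrow {D} s
    in σ , pointwise (p ∘H σ) (idH) λ y →
         Eq-trans (discrete X) (Eq-refl (discrete X) assoc)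
           (Eq-trans (discrete X) (s-eq y) (Eq-refl (discrete X) (≈sym identityˡ)))

  discrete-cover : (A : PER) → Σ PER λ Y → Σ (PERHom Y A) λ p → 𝓔l.ChoiceObject Y × 𝓔l.Surjective p
  discrete-cover A =
    discrete ∣ A ∣ , discrete-arrow {A} id , discrete-choice ∣ A ∣ ,
    λ y → elt {discrete ∣ A ∣} (fun y) , Eq-refl A identityˡ

  -- The given diagram is compared with the constructed sum, whose carrier is a sum in C. The
  -- element is located there, and the comparison back recovers it in `S`.
  indecomposable : 𝓔l.IndecomposableTerminal
  indecomposable {A} {B} {S} i j isCoproduct z =
    locate (+-elem (fun u ∘ fun z))
    where
    open Coproductₑ A B
    mediator = isCoproduct inl inr
    u = proj₁ mediator
    v = copair i j

    v∘u : ∀ s → Eq S (fun v ∘ (fun u ∘ s)) s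
    v∘u s =
      let m , _ , _ , only = isCoproduct i j
          p = only (v ∘H u)
            (pointwise ((v ∘H u) ∘H i) i λ x → Eq-trans S (Eq-refl S (assoc ⟩∘⟨refl ⨾ assoc))
              (Eq-trans S (preserve v (at (u ∘H i) inl (proj₁ (proj₂ mediator)) x))
                (Eq-refl S (pullˡ [,]-i₁))))
            (pointwise ((v ∘H u) ∘H j) j λ x → Eq-trans S (Eq-refl S (assoc ⟩∘⟨refl ⨾ assoc))
              (Eq-trans S (preserve v (at (u ∘H j) inr (proj₁ (proj₂ (proj₂ mediator))) x))
                (Eq-refl S (pullˡ [,]-i₂))))
          q = only idH
            (pointwise (idH ∘H i) i λ x → Eq-refl S (identityˡ ⟩∘⟨refl))
            (pointwise (idH ∘H j) j λ x → Eq-refl S (identityˡ ⟩∘⟨refl))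
      in Eq-trans S (Eq-refl S (≈sym assoc)) (Eq-trans S (at (v ∘H u) m p s)
           (Eq-trans S (Eq-sym S (at idH m q s)) (Eq-refl S identityˡ)))

    recover : ∀ {s} → s ≈ fun u ∘ fun z → Eq S (fun v ∘ s) (fun z)
    recover eq = Eq-trans S (Eq-refl S (refl⟩∘⟨ eq)) (v∘u (fun z))

    locate : ((fun u ∘ fun z) ∈[ i₁ ]) ⊎ ((fun u ∘ fun z) ∈[ i₂ ]) → (z 𝓔l.∈[ i ]) ⊎ (z 𝓔l.∈[ j ])
    locate (inj₁ (x , eq)) =
      inj₁ (elt {A} x , Eq-trans S (Eq-refl S (≈sym (pullˡ [,]-i₁))) (recover eq))
    locate (inj₂ (x , eq)) =
      inj₂ (elt {B} x , Eq-trans S (Eq-refl S (≈sym (pullˡ [,]-i₂))) (recover eq))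

  -- The comparison into the constructed sum would identify its two injections, against disjointness
  -- in C.
  summands-distinct : ∀ {S} (i j : 𝓔l.Elem S) → 𝓔.IsCoproduct i j → ¬ (i ∼ j)
  summands-distinct {S} i j isCoproduct i∼j =
    let u , ui , uj , _ = isCoproduct inl inr
    in apart (from Eq₊-rep (_ , _)
         (Eq-trans A+B (Eq-sym A+B (at (u ∘H i) inl ui id))
           (Eq-trans A+B (Eq-refl A+B identityʳ)
             (Eq-trans A+B (preserve u i∼j)
               (Eq-trans A+B (Eq-refl A+B (≈sym identityʳ)) (at (u ∘H j) inr uj id))))))
    where
    open Coproductₑ (discrete 𝟙) (discrete 𝟙)
    apart : ¬ Eq₊ (i₁ ∘ id) (i₂ ∘ id)
    apart (inj₁ (_ , _ , _ , p , _)) = i₁≉i₂ (≈sym p)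
    apart (inj₂ (_ , _ , p , _)) = i₁≉i₂ p

  -- The image has the carrier of `A` with equality of values in `B`: `p` is the identity on
  -- carriers, and `m` is `u` itself, now monic.
  image : (u : PERHom A B) → Σ PER λ Z → Σ (PERHom A Z) λ p → Σ (PERHom Z B) λ m →
          𝓔l.Surjective p × 𝓔.Mono m × ((m ∘H p) ∼ u)
  image {A} {B} u =
    restrict B (fun u) , p , include ,
    (λ y → elt {A} (fun y) , include-reflects (Eq-refl B (refl⟩∘⟨ identityˡ))) ,
    include-mono ,
    pointwise (include ∘H p) u (λ x → Eq-refl B (identityʳ ⟩∘⟨refl))
    where
    open Restrict B (fun u)
    p : PERHom A (restrict B (fun u))
    p = arrow {A} {restrict B (fun u)} id λ x y eq → include-reflects
      (Eq-trans B (Eq-refl B (refl⟩∘⟨ identityˡ))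
        (Eq-trans B (preserve u eq) (Eq-refl B (refl⟩∘⟨ ≈sym identityˡ))))

  -- Pullbacks, and equivalence relations as kernel pairs.

  pullbackₑ : (u : PERHom A D) (v : PERHom B D) →
    Σ PER λ P → Σ (PERHom P A) λ p₁ → Σ (PERHom P B) λ p₂ → 𝓔.IsPullback p₁ p₂ u v
  pullbackₑ {A} {D} {B} u v =
    P , fst ∘H m , snd ∘H m ,
    pointwise (u ∘H (fst ∘H m)) (v ∘H (snd ∘H m)) (λ x →
      Eq-trans D (Eq-refl D (≈sym assoc ⟩∘⟨refl))
        (Eq-trans D (at ((u ∘H fst) ∘H m) ((v ∘H snd) ∘H m) (proj₁ isEqualiser) x)
          (Eq-refl D (assoc ⟩∘⟨refl)))) ,
    λ {W} a b eq →
      let k , k-eq , k-unique = proj₂ isEqualiser (pair a b)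
            (pointwise ((u ∘H fst) ∘H pair a b) ((v ∘H snd) ∘H pair a b) λ x →
              Eq-trans D (Eq-refl D (pullʳ project₁ ⟩∘⟨refl))
                (Eq-trans D (at (u ∘H a) (v ∘H b) eq x)
                  (Eq-refl D (≈sym (pullʳ project₂) ⟩∘⟨refl))))
      in k
       , pointwise ((fst ∘H m) ∘H k) a (λ x →
           Eq-trans A (Eq-refl A (assoc ⟩∘⟨refl ⨾ assoc))
             (Eq-trans A (preserve fst (at (m ∘H k) (pair a b) k-eq x))
               (Eq-refl A (pullˡ project₁))))
       , pointwise ((snd ∘H m) ∘H k) b (λ x →
           Eq-trans B (Eq-refl B (assoc ⟩∘⟨refl ⨾ assoc))
             (Eq-trans B (preserve snd (at (m ∘H k) (pair a b) k-eq x))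
               (Eq-refl B (pullˡ project₂))))
       , λ k' p q → k-unique k' (proj₂ (proj₂ (proj₂ (isProduct a b))) (m ∘H k')
           (pointwise (fst ∘H (m ∘H k')) a λ x →
             Eq-trans A (Eq-refl A (≈sym assoc ⟩∘⟨refl)) (at ((fst ∘H m) ∘H k') a p x))
           (pointwise (snd ∘H (m ∘H k')) b λ x →
             Eq-trans B (Eq-refl B (≈sym assoc ⟩∘⟨refl)) (at ((snd ∘H m) ∘H k') b q x)))
    where
    open Productₑ A B
    open 𝓔.Product productₑ using (isProduct)
    open 𝓔.Equaliser (Equaliserₑ.equaliserₑ (u ∘H fst) (v ∘H snd))
      renaming (obj to P; arr to m)

  module Related {A B R : PER} (r : PERHom R (Productₑ.A×B A B)) where
    open Productₑ A B

    Rel : Elem ∣ A ∣ → Elem ∣ B ∣ → Set (ℓ ⊔ e)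
    Rel x y = Σ (Elem ∣ R ∣) λ w → Eq A×B (fun r ∘ w) ⟨ x , y ⟩

    rel-rep : ∀ {x : Env Γ → Elem ∣ A ∣} {y : Env Γ → Elem ∣ B ∣} →
              Term Γ x → Term Γ y → Rep Γ (λ γ → Rel (x γ) (y γ))
    rel-rep x y = ∃̇ ∣ R ∣ (Eqₜ A×B (fun r · v₀) ⟪ ↑ x , ↑ y ⟫ₜ)

    rel-resp : ∀ {x x' y y'} → Eq A x x' → Eq B y y' → Rel x y → Rel x' y'
    rel-resp p q (w , eq) = w , Eq-trans A×B eq (Eq-pair p q)

    rel-elem : ∀ w → Rel (π₁ ∘ (fun r ∘ w)) (π₂ ∘ (fun r ∘ w))
    rel-elem w = w , Eq-refl A×B η

  module Exactness {A : PER} (E : 𝓔l.EquivalenceRelation A) where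
    module E = 𝓔l.EquivalenceRelation E
    open Productₑ A A
    open Related {A} {A} {E.R} E.r

    rel-refl : ∀ {x} → Rel x x
    rel-refl {x} = fun E.ρ ∘ x ,
      Eq-trans A×B (Eq-refl A×B (≈sym assoc))
        (Eq-trans A×B (at (E.r ∘H E.ρ) (pair idH idH) E.ρ-eq x)
          (Eq-refl A×B (⟨⟩∘ ⨾ ⟨⟩-cong identityˡ identityˡ)))

    rel-sym : ∀ {x y} → Rel x y → Rel y x
    rel-sym {x} {y} (w , eq) = fun E.σ ∘ w ,
      Eq-trans A×B (Eq-refl A×B (≈sym assoc))
        (Eq-trans A×B (at (E.r ∘H E.σ) (pair (snd ∘H E.r) (fst ∘H E.r)) E.σ-eq w)
          (Eq-trans A×B (Eq-refl A×B (⟨⟩∘ ⨾ ⟨⟩-cong assoc assoc))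
            (Eq-pair (Eq-trans A (preserve snd eq) (Eq-refl A project₂))
                     (Eq-trans A (preserve fst eq) (Eq-refl A project₁)))))

    -- Transitivity is given on pullbacks only, so one is built and the composable pair of witnesses
    -- is turned into an element of it.
    rel-trans : ∀ {x y z} → Rel x y → Rel y z → Rel x z
    rel-trans {x} {y} {z} (w , eq) (v , eq') =
      let Q , p₁ , p₂ , isPullback = pullbackₑ (snd ∘H E.r) (fst ∘H E.r)
          t , t-eq = E.τ p₁ p₂ isPullback
          k , k₁ , k₂ , _ = proj₂ isPullback (elt {E.R} w) (elt {E.R} v)
            (Eq-trans A (Eq-refl A assoc) (Eq-trans A (preserve snd eq)
              (Eq-trans A (Eq-refl A (project₂ ⨾ ≈sym project₁))
                (Eq-trans A (Eq-sym A (preserve fst eq')) (Eq-refl A (≈sym assoc))))))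
      in fun t ∘ fun k ,
         Eq-trans A×B (Eq-refl A×B (≈sym assoc))
           (Eq-trans A×B (at (E.r ∘H t) (pair ((fst ∘H E.r) ∘H p₁) ((snd ∘H E.r) ∘H p₂)) t-eq (fun k))
             (Eq-trans A×B (Eq-refl A×B (⟨⟩∘ ⨾ ⟨⟩-cong assoc assoc))
               (Eq-pair
                 (Eq-trans A (preserve (fst ∘H E.r) k₁)
                   (Eq-trans A (Eq-refl A assoc) (Eq-trans A (preserve fst eq) (Eq-refl A project₁))))
                 (Eq-trans A (preserve (snd ∘H E.r) k₂)
                   (Eq-trans A (Eq-refl A assoc) (Eq-trans A (preserve snd eq') (Eq-refl A project₂)))))))

    abstract
      quotient-rep : Rep (⌈ ∣ A ∣ ⌉ ▹ ∣ A ∣) (λ (x , y) → Rel x y)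
      quotient-rep = rel-rep (↑ here) v₀

    A/E : PER
    A/E = quotient quotient-rep record { refl = rel-refl ; sym = rel-sym ; trans = rel-trans }

    project : PERHom A A/E
    project = arrow {A} {A/E} id λ x y eq → to quotient-rep (_ , _)
      (rel-resp (Eq-refl A (≈sym identityˡ)) (Eq-trans A eq (Eq-refl A (≈sym identityˡ))) rel-refl)

    related-of : ∀ {x y} → Eq A/E (id ∘ x) (id ∘ y) → Rel x y
    related-of eq = rel-resp (Eq-refl A identityˡ) (Eq-refl A identityˡ) (from quotient-rep (_ , _) eq)

    r-unique : ∀ {D : PER} (k k' : PERHom D E.R) →
      ((fst ∘H E.r) ∘H k) ∼ ((fst ∘H E.r) ∘H k') → ((snd ∘H E.r) ∘H k) ∼ ((snd ∘H E.r) ∘H k') →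
      k ∼ k'
    r-unique k k' p q = E.r-mono k k' (pointwise (E.r ∘H k) (E.r ∘H k') λ x →
      Eq-trans A×B (Eq-refl A×B (η ⨾ ⟨⟩-cong (≈sym assoc ⨾ ≈sym assoc ⟩∘⟨refl) (≈sym assoc ⨾ ≈sym assoc ⟩∘⟨refl)))
        (Eq-trans A×B
          (Eq-pair (at ((fst ∘H E.r) ∘H k) ((fst ∘H E.r) ∘H k') p x)
                   (at ((snd ∘H E.r) ∘H k) ((snd ∘H E.r) ∘H k') q x))
          (Eq-refl A×B (≈sym (η ⨾ ⟨⟩-cong (≈sym assoc ⨾ ≈sym assoc ⟩∘⟨refl) (≈sym assoc ⨾ ≈sym assoc ⟩∘⟨refl))))))

    module _ {D : PER} (a b : PERHom D A) (eq : (project ∘H a) ∼ (project ∘H b)) where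
      private
        choice-of-witness = choose (Eqₜ A×B (fun E.r · v₀) ⟪ fun a · ↑ here , fun b · ↑ here ⟫ₜ)
          λ x → related-of (Eq-trans A/E (Eq-refl A/E (≈sym assoc))
            (Eq-trans A/E (at (project ∘H a) (project ∘H b) eq x) (Eq-refl A/E assoc)))

        witness : ∣ D ∣ ⇒ ∣ E.R ∣
        witness = proj₁ choice-of-witness

        witness-eq : ∀ x → Eq A×B (fun E.r ∘ (witness ∘ x)) ⟨ fun a ∘ x , fun b ∘ x ⟩
        witness-eq = proj₂ choice-of-witness

      -- Witnesses are chosen pointwise; since `E.r` is monic it reflects equality, and so the
      -- choice respects that of `D`.
      lifting : PERHom D E.R
      lifting = arrow {D} {E.R} witness λ x y eq → mono-reflects E.r E.r-mono _ _
        (Eq-trans A×B (witness-eq x)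
          (Eq-trans A×B (Eq-pair (preserve a eq) (preserve b eq)) (Eq-sym A×B (witness-eq y))))

      lifting-fst : ((fst ∘H E.r) ∘H lifting) ∼ a
      lifting-fst = pointwise ((fst ∘H E.r) ∘H lifting) a λ x →
        Eq-trans A (Eq-refl A (assoc ⟩∘⟨refl ⨾ assoc ⨾ refl⟩∘⟨ assoc))
          (Eq-trans A (preserve fst (witness-eq x)) (Eq-refl A project₁))

      lifting-snd : ((snd ∘H E.r) ∘H lifting) ∼ b
      lifting-snd = pointwise ((snd ∘H E.r) ∘H lifting) b λ x →
        Eq-trans A (Eq-refl A (assoc ⟩∘⟨refl ⨾ assoc ⨾ refl⟩∘⟨ assoc))
          (Eq-trans A (preserve snd (witness-eq x)) (Eq-refl A project₂))

    isKernelPair : 𝓔l.IsKernelPair (fst ∘H E.r) (snd ∘H E.r)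
    isKernelPair = A/E , project
      , pointwise (project ∘H (fst ∘H E.r)) (project ∘H (snd ∘H E.r)) (λ w →
          to quotient-rep (_ , _) (rel-resp
            (Eq-refl A (≈sym (identityˡ ⟩∘⟨refl ⨾ assoc)))
            (Eq-refl A (≈sym (identityˡ ⟩∘⟨refl ⨾ assoc))) (rel-elem w)))
      , λ {D} a b eq → lifting a b eq , lifting-fst a b eq , lifting-snd a b eq ,
          λ k' p q → r-unique k' (lifting a b eq)
            (∼-trans {u = (fst ∘H E.r) ∘H k'} {v = a} {w = (fst ∘H E.r) ∘H lifting a b eq} p
              (∼-sym {u = (fst ∘H E.r) ∘H lifting a b eq} {v = a} (lifting-fst a b eq)))
            (∼-trans {u = (snd ∘H E.r) ∘H k'} {v = b} {w = (snd ∘H E.r) ∘H lifting a b eq} q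
              (∼-sym {u = (snd ∘H E.r) ∘H lifting a b eq} {v = b} (lifting-snd a b eq)))

  -- Universal dependent products.

  module DependentProduct {I X Y : PER} (g : PERHom Y X) (f : PERHom X I) where
    open Productₑ X Y using () renaming (A×B to X×Y; Eq-pair to Eq-XY)
    private
      module XY = Productₑ X Y

    -- The fibres of f and g up to the equalities of I and X, displayed over I in C.
    fibre-f : Rep (⌈ ∣ I ∣ ⌉ ▹ ∣ X ∣) (λ (i , x) → Eq I (fun f ∘ x) i)
    fibre-f = Eqₜ I (fun f · v₀) (↑ here)

    X′ : Obj
    X′ = Ext fibre-f

    index : X′ ⇒ ∣ I ∣
    index = π₁ ∘ ext fibre-f

    toX : X′ ⇒ ∣ X ∣
    toX = π₂ ∘ ext fibre-f

    fibre-g : Rep (⌈ X′ ⌉ ▹ ∣ Y ∣) (λ (x , y) → Eq X (fun g ∘ y) (toX ∘ x))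
    fibre-g = Eqₜ X (fun g · v₀) (toX · ↑ here)

    Y′ : Obj
    Y′ = Ext fibre-g

    over : Y′ ⇒ X′
    over = π₁ ∘ ext fibre-g

    toY : Y′ ⇒ ∣ Y ∣
    toY = π₂ ∘ ext fibre-g

    index-toX : ∀ (x : Elem X′) → Eq I (fun f ∘ (toX ∘ x)) (index ∘ x)
    index-toX x = from fibre-f (_ , _) (x , (η ⨾ ⟨⟩-cong (≈sym assoc) (≈sym assoc)))

    over-toY : ∀ (y : Elem Y′) → Eq X (fun g ∘ (toY ∘ y)) (toX ∘ (over ∘ y))
    over-toY y = from fibre-g (_ , _) (y , (η ⨾ ⟨⟩-cong (≈sym assoc) (≈sym assoc)))

    elemX′ : ∀ i x → Eq I (fun f ∘ x) i → Σ (Elem X′) λ x′ → (index ∘ x′ ≈ i) × (toX ∘ x′ ≈ x)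
    elemX′ i x eq =
      let w , w-eq = to fibre-f (i , x) eq
      in w , (pullʳ w-eq ⨾ project₁) , (pullʳ w-eq ⨾ project₂)

    elemY′ : ∀ x y → Eq X (fun g ∘ y) (toX ∘ x) →
             Σ (Elem Y′) λ y′ → (over ∘ y′ ≈ x) × (toY ∘ y′ ≈ y)
    elemY′ x y eq =
      let w , w-eq = to fibre-g (x , y) eq
      in w , (pullʳ w-eq ⨾ project₁) , (pullʳ w-eq ⨾ project₂)

    open FullFamily (closed over index)
      using (full) renaming (F to F₀; φ to φ₀; P to P₀; α to α₀; isFamily to isFamily₀)

    -- An index of a full family is only a multivalued function; the extensional
    -- indices are the elements of the dependent product in the completion.
    Value : Elem F₀ → Elem ∣ X ∣ → Elem ∣ Y ∣ → Set (ℓ ⊔ e)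
    Value c x y = Σ (Elem X′) λ x′ → Σ (Elem Y′) λ y′ →
      ⟪ c , x′ , y′ ⟫ ∈[ α₀ ] × Eq X (toX ∘ x′) x × Eq Y (toY ∘ y′) y

    abstract
      value-rep : ∀ {c : Env Γ → Elem F₀} {x : Env Γ → Elem ∣ X ∣} {y : Env Γ → Elem ∣ Y ∣} →
                  Term Γ c → Term Γ x → Term Γ y → Rep Γ (λ γ → Value (c γ) (x γ) (y γ))
      value-rep c x y = ∃̇ X′ (∃̇ Y′
        ( mem α₀ ⟪ ↑ (↑ c) , ⟪ ↑ v₀ , v₀ ⟫ₜ ⟫ₜ
        ∧ Eqₜ X (toX · ↑ v₀) (↑ (↑ x))
        ∧ Eqₜ Y (toY · v₀) (↑ (↑ y))))

    value-resp : ∀ {c c' x x' y y'} → c ≈ c' → Eq X x x' → Eq Y y y' → Value c x y → Value c' x' y'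
    value-resp p q s (x′ , y′ , m , x-eq , y-eq) =
      x′ , y′ , ∈-resp (⟨⟩-cong p ≈refl) m , Eq-trans X x-eq q , Eq-trans Y y-eq s

    value-over : ∀ {c x y} → Value c x y → Eq X (fun g ∘ y) x
    value-over (x′ , y′ , m , x-eq , y-eq) =
      Eq-trans X (preserve g (Eq-sym Y y-eq)) (Eq-trans X (over-toY y′)
        (Eq-trans X (Eq-refl X (refl⟩∘⟨ proj₁ isFamily₀ _ _ _ m)) x-eq))

    value-index : ∀ {c x y} → Value c x y → Eq I (fun f ∘ x) (φ₀ ∘ c)
    value-index (x′ , y′ , m , x-eq , y-eq) =
      Eq-trans I (preserve f (Eq-sym X x-eq)) (Eq-trans I (index-toX x′)
        (Eq-refl I (proj₂ (proj₂ isFamily₀ _ x′) (y′ , m))))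

    value-total : ∀ {c x} → Eq I (fun f ∘ x) (φ₀ ∘ c) → Σ (Elem ∣ Y ∣) (Value c x)
    value-total {c} {x} eq =
      let x′ , i-eq , x-eq = elemX′ _ x eq
          y′ , m = proj₁ (proj₂ isFamily₀ c x′) i-eq
      in toY ∘ y′ , x′ , y′ , m , Eq-refl X x-eq , Eq-refl Y ≈refl

    -- Single-valuedness suffices: `Value` is saturated under the equalities of `X` and `Y` by its
    -- definition.
    Extensional : Elem F₀ → Set (ℓ ⊔ e)
    Extensional c = ∀ x y y' → Value c x y → Value c x y' → Eq Y y y'

    abstract
      extensional-rep : Rep ⌈ F₀ ⌉ Extensional
      extensional-rep = ∀̇ ∣ X ∣ (∀̇ ∣ Y ∣ (∀̇ ∣ Y ∣
        (value-rep (↑ (↑ (↑ here))) (↑ (↑ v₀)) (↑ v₀) ⊃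
         value-rep (↑ (↑ (↑ here))) (↑ (↑ v₀)) v₀ ⊃
         Eqₜ Y (↑ v₀) v₀)))

    F₁ : Obj
    F₁ = Ext extensional-rep

    ε : F₁ ⇒ F₀
    ε = ext extensional-rep

    -- The index is compared separately because over empty fibres all functions have the same
    -- values, namely none.
    SameFunction : Elem F₁ → Elem F₁ → Set (ℓ ⊔ e)
    SameFunction c d = Eq I (φ₀ ∘ (ε ∘ c)) (φ₀ ∘ (ε ∘ d)) ×
      (∀ x y → (Value (ε ∘ c) x y → Value (ε ∘ d) x y) × (Value (ε ∘ d) x y → Value (ε ∘ c) x y))

    abstract
      same-rep : Rep (⌈ F₁ ⌉ ▹ F₁) (λ (c , d) → SameFunction c d)
      same-rep = Eqₜ I (φ₀ · ε · ↑ here) (φ₀ · ε · v₀) ∧ ∀̇ ∣ X ∣ (∀̇ ∣ Y ∣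
        ( (value-rep (ε · ↑ (↑ (↑ here))) (↑ v₀) v₀ ⊃ value-rep (ε · ↑ (↑ v₀)) (↑ v₀) v₀)
        ∧ (value-rep (ε · ↑ (↑ v₀)) (↑ v₀) v₀ ⊃ value-rep (ε · ↑ (↑ (↑ here))) (↑ v₀) v₀)))

    F : PER
    F = quotient same-rep record
      { refl = Eq-refl I ≈refl , λ x y → (λ t → t) , (λ t → t)
      ; sym = λ (p , q) → Eq-sym I p , λ x y → proj₂ (q x y) , proj₁ (q x y)
      ; trans = λ (p , q) (p' , q') → Eq-trans I p p' , λ x y →
          (λ t → proj₁ (q' x y) (proj₁ (q x y) t)) , (λ t → proj₂ (q x y) (proj₂ (q' x y) t))
      }

    φ : PERHom F I
    φ = arrow {F} {I} (φ₀ ∘ ε) λ c d eq → Eq-trans I (Eq-refl I assoc)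
      (Eq-trans I (proj₁ (from same-rep (c , d) eq)) (Eq-refl I (≈sym assoc)))

    open Productₑ F X×Y using () renaming (A×B to F×X×Y; Eq-pair to Eq-FXY)
    private
      module FXY = Productₑ F X×Y

    abstract
      graph-rep : Rep ⌈ ∣ F×X×Y ∣ ⌉ (λ p → Value (ε ∘ (π₁ ∘ p)) (π₁ ∘ (π₂ ∘ p)) (π₂ ∘ (π₂ ∘ p)))
      graph-rep = value-rep (ε · π₁ · here) (π₁ · π₂ · here) (π₂ · π₂ · here)

    module G = Restrict F×X×Y (ext graph-rep)

    P : PER
    P = restrict F×X×Y (ext graph-rep)

    α : PERHom P F×X×Y
    α = G.include

    value⇒graph : ∀ (c : 𝓔l.Elem F) (x : 𝓔l.Elem X) (y : 𝓔l.Elem Y) →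
      Value (ε ∘ fun c) (fun x) (fun y) → FXY.pair c (XY.pair x y) 𝓔l.∈[ α ]
    value⇒graph c x y t =
      let w , w-eq = to graph-rep ⟪ fun c , fun x , fun y ⟫
            (value-resp (≈sym (refl⟩∘⟨ project₁))
              (Eq-refl X (≈sym (refl⟩∘⟨ project₂ ⨾ project₁)))
              (Eq-refl Y (≈sym (refl⟩∘⟨ project₂ ⨾ project₂))) t)
      in elt {P} w , Eq-refl F×X×Y w-eq

    graph⇒value : ∀ (c : 𝓔l.Elem F) (x : 𝓔l.Elem X) (y : 𝓔l.Elem Y) →
      FXY.pair c (XY.pair x y) 𝓔l.∈[ α ] → Value (ε ∘ fun c) (fun x) (fun y)
    graph⇒value c x y (w , eq) =
      let p = ext graph-rep ∘ fun w
          t = from graph-rep p (fun w , ≈refl)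
          c-eq = Eq-trans F (preserve FXY.fst eq) (Eq-refl F project₁)
          xy-eq = Eq-trans X×Y (preserve FXY.snd eq) (Eq-refl X×Y project₂)
      -- Equality in `F` is `SameFunction`, which transports the value found at the witness to `c`.
      in proj₁ (proj₂ (from same-rep (π₁ ∘ p , fun c) c-eq) (fun x) (fun y))
           (value-resp ≈refl
             (Eq-trans X (preserve XY.fst xy-eq) (Eq-refl X project₁))
             (Eq-trans Y (preserve XY.snd xy-eq) (Eq-refl Y project₂)) t)

    isFamily : 𝓔l.IsFamily f g φ α
    isFamily =
      (λ c x y m → value-over (graph⇒value c x y m)) ,
      λ c x →
        (λ eq → let y , t = value-total (Eq-trans I eq (Eq-refl I assoc))
                in elt {Y} y , value⇒graph c x (elt {Y} y) t) ,
        λ { (y , m) → Eq-trans I (value-index (graph⇒value c x y m)) (Eq-refl I (≈sym assoc)) }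

    functional : 𝓔l.FunctionalFamily α
    functional c x x' y y' m m' x∼x' =
      from extensional-rep (ε ∘ fun c) (fun c , ≈refl) (fun x') (fun y) (fun y')
        (value-resp ≈refl x∼x' (Eq-refl Y ≈refl) (graph⇒value c x y m))
        (graph⇒value c x' y' m')

    module Universal (i : 𝓔l.Elem I) {R : PER} (r : PERHom R X×Y)
        (pseudo : 𝓔l.IsPseudoRel f g i r) (functional-r : 𝓔l.FunctionalRel r) where
      open Related {X} {Y} {R} r

      rel-∈ : ∀ (x : 𝓔l.Elem X) (y : 𝓔l.Elem Y) → Rel (fun x) (fun y) → XY.pair x y 𝓔l.∈[ r ]
      rel-∈ x y (w , eq) = elt {R} w , eq

      ∈-rel : ∀ (x : 𝓔l.Elem X) (y : 𝓔l.Elem Y) → XY.pair x y 𝓔l.∈[ r ] → Rel (fun x) (fun y)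
      ∈-rel x y (w , eq) = fun w , eq

      rel-over : ∀ {x y} → Rel x y → Eq X (fun g ∘ y) x
      rel-over {x} {y} t = proj₁ pseudo (elt {X} x) (elt {Y} y) (rel-∈ (elt {X} x) (elt {Y} y) t)

      rel-total : ∀ {x} → Eq I (fun f ∘ x) (fun i) → Σ (Elem ∣ Y ∣) (Rel x)
      rel-total {x} eq =
        let y , m = proj₁ (proj₂ pseudo (elt {X} x)) eq in fun y , ∈-rel (elt {X} x) y m

      rel-index : ∀ {x y} → Rel x y → Eq I (fun f ∘ x) (fun i)
      rel-index {x} {y} t =
        proj₂ (proj₂ pseudo (elt {X} x)) (elt {Y} y , rel-∈ (elt {X} x) (elt {Y} y) t)

      rel-functional : ∀ {x y y'} → Rel x y → Rel x y' → Eq Y y y'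
      rel-functional {x} {y} {y'} t t' =
        functional-r (elt {X} x) (elt {X} x) (elt {Y} y) (elt {Y} y')
          (rel-∈ (elt {X} x) (elt {Y} y) t) (rel-∈ (elt {X} x) (elt {Y} y') t') (Eq-refl X ≈refl)

      abstract
        -- `r` transferred to the fibres displayed in C. The index is compared by `≈`, as a domain
        -- index in C demands; nothing is lost, since any `x` that `f` sends to `i` up to `Eq I` has
        -- a copy in `X′` with index exactly `fun i`.
        r′-rep : Rep (⌈ X′ ⌉ ▹ Y′)
          (λ (x , y) → (over ∘ y ≈ x) × (index ∘ x ≈ fun i) × Rel (toX ∘ x) (toY ∘ y))
        r′-rep = (over · v₀ ≐ ↑ here) ∧ (index · ↑ here ≐ const (fun i))
               ∧ rel-rep (toX · ↑ here) (toY · v₀)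

      r′-pseudo : IsPseudoRel index over (fun i) (ext r′-rep)
      r′-pseudo = (λ x y m → proj₁ (from r′-rep (x , y) m)) , λ x →
        (λ eq → let y , t = rel-total (Eq-trans I (index-toX x) (Eq-refl I eq))
                    y′ , over-eq , y-eq = elemY′ x y (rel-over t)
                in y′ , to r′-rep (x , y′)
                     (over-eq , eq , rel-resp (Eq-refl X ≈refl) (Eq-refl Y (≈sym y-eq)) t)) ,
        λ { (y , m) → proj₁ (proj₂ (from r′-rep (x , y) m)) }

      code : Elem F₀
      code = proj₁ (full (fun i) (ext r′-rep) r′-pseudo)

      code-index : φ₀ ∘ code ≈ fun i
      code-index = proj₁ (proj₂ (full (fun i) (ext r′-rep) r′-pseudo))

      value⇒rel : ∀ {x y} → Value code x y → Rel x y
      value⇒rel (x′ , y′ , m , x-eq , y-eq) = rel-resp x-eq y-eq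
        (proj₂ (proj₂ (from r′-rep (x′ , y′)
          (proj₂ (proj₂ (full (fun i) (ext r′-rep) r′-pseudo)) x′ y′ m))))

      -- Fullness yields the other inclusion only. Here the code has some value at `x`, that value
      -- is related to `x` by `r`, and functionality of `r` equates it with `y`.
      rel⇒value : ∀ {x y} → Rel x y → Value code x y
      rel⇒value t =
        let y₁ , t₁ = value-total (Eq-trans I (rel-index t) (Eq-refl I (≈sym code-index)))
        in value-resp ≈refl (Eq-refl X ≈refl) (rel-functional (value⇒rel t₁) t) t₁

      extensional-code : code ∈[ ε ]
      extensional-code = to extensional-rep code
        λ x y y' t t' → rel-functional (value⇒rel t) (value⇒rel t')

      name : 𝓔l.Elem F
      name = elt {F} (proj₁ extensional-code)

      ε-name : ε ∘ fun name ≈ code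
      ε-name = proj₂ extensional-code

      name-index : (φ ∘H name) ∼ i
      name-index = Eq-refl I (pullʳ ε-name ⨾ code-index)

      Represents : 𝓔l.Elem F → Set _
      Represents c = ∀ (x : 𝓔l.Elem X) (y : 𝓔l.Elem Y) →
        (FXY.pair c (XY.pair x y) 𝓔l.∈[ α ]) iff (XY.pair x y 𝓔l.∈[ r ])

      name-represents : Represents name
      name-represents x y =
        (λ m → rel-∈ x y (value⇒rel (value-resp ε-name (Eq-refl X ≈refl) (Eq-refl Y ≈refl)
                 (graph⇒value name x y m)))) ,
        (λ m → value⇒graph name x y (value-resp (≈sym ε-name) (Eq-refl X ≈refl) (Eq-refl Y ≈refl)
                 (rel⇒value (∈-rel x y m))))

      name-unique : ∀ c → (φ ∘H c) ∼ i → Represents c → c ∼ name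
      name-unique c c-index c-represents = to same-rep (fun c , fun name)
        ( Eq-trans I (Eq-refl I (≈sym assoc))
            (Eq-trans I c-index (Eq-trans I (Eq-sym I name-index) (Eq-refl I assoc)))
        , λ x y →
            let x̂ = elt {X} x
                ŷ = elt {Y} y
            in (λ t → graph⇒value name x̂ ŷ
                   (proj₂ (name-represents x̂ ŷ) (proj₁ (c-represents x̂ ŷ) (value⇒graph c x̂ ŷ t))))
             , (λ t → graph⇒value c x̂ ŷ
                   (proj₂ (c-represents x̂ ŷ) (proj₁ (name-represents x̂ ŷ) (value⇒graph name x̂ ŷ t)))) )

    universalDependentProduct : 𝓔l.UniversalDependentProduct f g
    universalDependentProduct = record
      { F = F ; φ = φ ; P = P ; α = α
      ; α-mono = G.include-mono
      ; isFamily = isFamily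
      ; functional = functional
      ; universal = λ i {R} r mono pseudo functional-r →
          let open Universal i {R} r pseudo functional-r
          in name , (name-index , name-represents) , name-unique
      }

  axioms : CETCSAxioms.Axioms Cex finiteLimits finiteColimits
  axioms = record
    { C2 = DependentProduct.universalDependentProduct
    ; C3 = nno
    ; C4-strong = strong-generator
    ; C4-separating = λ {A} u v eq → pointwise u v λ x → eq (elt {A} x)
    ; C5 = discrete-cover
    ; C6 = λ x → initial-empty (fun x)
    ; C7 = indecomposable
    ; C8 = summands-distinct
    ; C9 = image
    ; C10 = Exactness.isKernelPair
    }

theorem5p9 : ∀ {o ℓ e} (C : Category o ℓ e)
    (fp : Notions.FiniteProducts C)
    (we : Notions.WeakEqualisers C)
    (fs : Notions.FiniteSums C) →
    (∀ (X : Category.Obj C) →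
    Elements.ChoiceObject C (Notions.FiniteProducts.terminal fp)
    (Notions.FiniteProducts.product fp) X) →
    Elements.NonDegenerate C (Notions.FiniteProducts.terminal fp)
    (Notions.FiniteProducts.product fp) (Notions.FiniteSums.initial fs) →
    Elements.IndecomposableTerminal C (Notions.FiniteProducts.terminal fp)
    (Notions.FiniteProducts.product fp) →
    Lextensive.WeaklyLextensive C fp fs →
    Elements.ClosedForPseudoRelations C (Notions.FiniteProducts.terminal fp)
    (Notions.FiniteProducts.product fp) →
    Elements.WeakNNO C (Notions.FiniteProducts.terminal fp)
    (Notions.FiniteProducts.product fp) →
    ModelOfCETCS (ExactCompletion.Cex C fp we)
theorem5p9 C fp we fs choice nondeg indec lext closed wnno = record
  { finiteLimits   = finiteLimits
  ; finiteColimits = finiteColimits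
  ; axioms         = axioms
  }
  where open Completion C fp we fs choice nondeg indec lext closed wnno
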